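{- Let $G$ be a connected bipartite graph with color classes $E$ and $V$, with any ribbon structure, base node and base edge. Then the simplices $Q_T$, where $T$ ranges over the $V$-cut Jaeger trees of $G$, form a dissection of the root polytope $Q_G$.
   Context: For a bipartite graph $G$ with color classes $E$ (emerald) and $V$ (violet), in $\mathbb R^E\oplus\mathbb R^V$ with standard basis vectors $\mathbf x$ ($x\in E\cup V$), the root polytope is $Q_G=\mathrm{conv}\{\mathbf e+\mathbf v: ev \text{ an edge of } G\}$; for a spanning tree $T$, $Q_T$ is the corresponding simplex (a maximal-dimensional simplex in $Q_G$). A dissection of $Q_G$ is a collection of maximal-dimensional simplices whose union is $Q_G$ and whose interiors are pairwise disjoint. A ribbon structure assigns to each node $x$ a cyclic permutation of its incident edges; $xy^+$ is the edge following $xy$ at $x$. Base node $b_0$, incident base edge $b_0b_1$. Tour of a spanning tree $T$: pairs (current node, current edge) starting with $(b_0,b_0b_1)$; from $(x,xy)$ go to $(x,xy^+)$ if $xy\notin T$, to $(y,yx^+)$ if $xy\in T$; stop right before $(b_0,b_0b_1)$ recurs. Each edge $xy$ appears exactly twice, as $(x,xy)$ and $(y,xy)$; a non-edge $xy$ of $T$ is cut at $x$ if $(x,xy)$ comes first. $T$ is a $V$-cut Jaeger tree if every edge of $G$ not in $T$ is cut at its endpoint in $V$.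
   Formalization: The points of the root polytope and of the simplices, and the coefficients of their convex combinations, are taken with rational rather than real coordinates. -}

module Defs where

open import Data.Nat using (ℕ; zero; suc; _≤_; _<_)
open import Data.Fin using (Fin; zero; suc; _≟_)
open import Data.Bool using (Bool; true; false; if_then_else_)
open import Data.Sum using (_⊎_; inj₁; inj₂)
open import Data.Product using (Σ; ∃; ∃-syntax; _×_; _,_)
open import Data.Rational using (ℚ; 0ℚ; 1ℚ; _+_; _*_) renaming (_≤_ to _≤ℚ_; _<_ to _<ℚ_)
open import Relation.Nullary using (¬_)
open import Relation.Nullary.Decidable using (⌊_⌋)
open import Relation.Binary.PropositionalEquality using (_≡_; _≢_)

iter : ∀ {A : Set} → (A → A) → ℕ → A → A
iter f zero    a = a
iter f (suc j) a = f (iter f j a)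

sumFin : ∀ {k} → (Fin k → ℚ) → ℚ
sumFin {zero}  f = 0ℚ
sumFin {suc k} f = f zero + sumFin (λ i → f (suc i))

-- Bipartite graphs: emerald class E = Fin m, violet class V = Fin n,
-- edges indexed by Fin k; edge e joins emerald node em e and violet node vi e.

record BipartiteGraph (m n k : ℕ) : Set where
  field
    em : Fin k → Fin m
    vi : Fin k → Fin n
    simple : ∀ e f → em e ≡ em f → vi e ≡ vi f → e ≡ f

Node : ℕ → ℕ → Set
Node m n = Fin m ⊎ Fin n

module _ {m n k : ℕ} (G : BipartiteGraph m n k) where
  open BipartiteGraph G

  Inc : Node m n → Fin k → Set
  Inc x e = (x ≡ inj₁ (em e)) ⊎ (x ≡ inj₂ (vi e))

  -- the other endpoint of e, seen from node x (meaningful when Inc x e)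
  other : Node m n → Fin k → Node m n
  other (inj₁ _) e = inj₂ (vi e)
  other (inj₂ _) e = inj₁ (em e)

  EdgeSet : Set
  EdgeSet = Fin k → Bool

  remove : EdgeSet → Fin k → EdgeSet
  remove S e f = if ⌊ f ≟ e ⌋ then false else S f

  data Reach (S : EdgeSet) : Node m n → Node m n → Set where
    here : ∀ {x} → Reach S x x
    step : ∀ {x y e} → S e ≡ true → Inc x e → Reach S (other x e) y → Reach S x y

  ConnectedSub : EdgeSet → Set
  ConnectedSub S = ∀ x y → Reach S x y

  Connected : Set
  Connected = ConnectedSub (λ _ → true)

  SpanningTree : EdgeSet → Set
  SpanningTree T = ConnectedSub T ×
    (∀ e → T e ≡ true → ¬ Reach (remove T e) (inj₁ (em e)) (inj₂ (vi e)))

  -- ribbon structure: at every node x, a cyclic permutation ρ x of the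
  -- edges incident to x (its values on non-incident edges are irrelevant);
  -- ρ x e is the edge xy⁺ following e = xy at x.
  record RibbonStructure : Set where
    field
      ρ : Node m n → Fin k → Fin k
      ρ-inc : ∀ x e → Inc x e → Inc x (ρ x e)
      ρ-cyclic : ∀ x e f → Inc x e → Inc x f → ∃[ j ] iter (ρ x) j e ≡ f

  module _ (R : RibbonStructure) where
    open RibbonStructure R

    tourStep : EdgeSet → Node m n × Fin k → Node m n × Fin k
    tourStep T (x , e) =
      if T e then (other x e , ρ (other x e) e) else (x , ρ x e)

    InTourAt : EdgeSet → Node m n × Fin k → ℕ → Node m n × Fin k → Set
    InTourAt T s₀ i p = iter (tourStep T) i s₀ ≡ p ×
      (∀ j → 1 ≤ j → j ≤ i → iter (tourStep T) j s₀ ≢ s₀)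

    CutAt : EdgeSet → Node m n × Fin k → Node m n → Fin k → Set
    CutAt T s₀ x e = ∃[ i ] (InTourAt T s₀ i (x , e) ×
      (∀ j → j ≤ i → iter (tourStep T) j s₀ ≢ (other x e , e)))

    VCutJaeger : Node m n → Fin k → EdgeSet → Set
    VCutJaeger b₀ b T = SpanningTree T ×
      (∀ e → T e ≡ false → CutAt T (b₀ , b) (inj₂ (vi e)) e)

  Point : Set
  Point = Node m n → ℚ

  indicator : Node m n → Fin k → ℚ
  indicator (inj₁ a) e = if ⌊ a ≟ em e ⌋ then 1ℚ else 0ℚ
  indicator (inj₂ v) e = if ⌊ v ≟ vi e ⌋ then 1ℚ else 0ℚ

  -- p is the convex combination with coefficients λ of the points 𝐞+𝐯 (ev edge)
  IsCombination : (Fin k → ℚ) → Point → Set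
  IsCombination c p = (∀ e → 0ℚ ≤ℚ c e) × sumFin c ≡ 1ℚ ×
    (∀ x → p x ≡ sumFin (λ e → c e * indicator x e))

  InQG : Point → Set
  InQG p = ∃[ c ] IsCombination c p

  InQT : EdgeSet → Point → Set
  InQT T p = ∃[ c ] (IsCombination c p × (∀ e → T e ≡ false → c e ≡ 0ℚ))

  InInteriorQT : EdgeSet → Point → Set
  InInteriorQT T p = ∃[ c ] (IsCombination c p × (∀ e → T e ≡ false → c e ≡ 0ℚ)
    × (∀ e → T e ≡ true → 0ℚ <ℚ c e))

  Dissects : (EdgeSet → Set) → Set
  Dissects P =
    (∀ p → InQG p → ∃[ T ] (P T × InQT T p)) ×
    (∀ T p → P T → InQT T p → InQG p) ×
    (∀ T T' → P T → P T' → ¬ (∀ e → T e ≡ T' e) →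
      ∀ p → ¬ (InInteriorQT T p × InInteriorQT T' p))

{-# OPTIONS --safe #-}

-- A tour can cross the fundamental cut of g ∈ T only along g, so once it has entered the far side
-- of g it exhausts that side before it is seen on the near side again.
--
-- Disjoint interiors: where the tours of two Jaeger trees T, T′ first differ, they are at the
-- violet end of some g, say g ∈ T \ T′.  By the tour property, among the edges of T ∪ T′ across the
-- fundamental cut of g in T, the only one with its emerald end on the far side is g itself.  So the
-- net flow across that cut separates the interior of Q_T from Q_T′.
--
-- Covering: cancelling cycles gives some spanning tree T with p ∈ Q_T.  If an edge f ∉ T is cut at
-- its emerald end, let f enter the basis by a simplex pivot, with g leaving.  The tour property
-- shows that the tours of T and T + f − g first differ either at the emerald end of f or at the
-- violet end of g.  Hence, reading along the tour "in T at a violet node" and "not in T at an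
-- emerald node" as binary digits 1, the pivot decreases the resulting number.

module Submission where

open import Defs
open import Algebra.Bundles using (CommutativeRing)
open import Data.Bool using (Bool; true; false; if_then_else_; not; _xor_)
import Data.Bool.Properties as Bool
open import Data.Bool.Properties using (¬-not)
open import Data.Fin using (Fin; zero; suc; _≟_; toℕ; join; splitAt; combine)
import Data.Fin.Properties as Fin
open import Data.List using (List; []; _∷_; allFin)
open import Data.List.Membership.Propositional using (_∈_)
open import Data.List.Membership.Propositional.Properties using (∈-allFin)
open import Data.List.Relation.Unary.Any using (here; there)
open import Data.Nat as ℕ using (ℕ; zero; suc; s≤s; _≤_; _<_; _∸_)
open import Data.Nat.Induction using (<-wellFounded)
import Data.Nat.Properties as ℕ
open import Data.Nat.Tactic.RingSolver using (solve-∀)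
open import Data.Product using (Σ-syntax; ∃; ∃-syntax; _×_; _,_; proj₁; proj₂)
import Data.Product.Properties as Product
open import Data.Rational using (ℚ; 0ℚ; 1ℚ; _+_; _*_; -_; 1/_; positive; nonNegative; ≢-nonZero)
  renaming (_≤_ to _≤ℚ_; _<_ to _<ℚ_)
import Data.Rational.Properties as ℚ
import Data.Rational.Solver
open import Data.Sum using (_⊎_; inj₁; inj₂)
import Data.Sum.Properties as Sum⊎
open import Function using (_∘_)
open import Induction.WellFounded using (Acc; acc)
open import Relation.Binary using (tri<; tri≈; tri>)
open import Relation.Binary.PropositionalEquality
  using (_≡_; _≢_; refl; sym; trans; cong; cong₂; subst; module ≡-Reasoning)
open import Relation.Nullary using (¬_; Dec; yes; no; contradiction; ¬?; _×-dec_)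
open import Relation.Nullary.Decidable using (⌊_⌋)
open import Relation.Unary using (Decidable)

import Algebra.Properties.CommutativeMonoid.Sum ℚ.+-0-commutativeMonoid as Sum
import Algebra.Properties.Semiring.Sum
  (CommutativeRing.semiring ℚ.+-*-commutativeRing) as ScaledSum

-- Rational sums

sumFin≡sum : ∀ {k} (f : Fin k → ℚ) → sumFin f ≡ Sum.sum f
sumFin≡sum {zero}  f = refl
sumFin≡sum {suc k} f = cong (f zero +_) (sumFin≡sum (f ∘ suc))

sum-cong : ∀ {k} {f g : Fin k → ℚ} → (∀ i → f i ≡ g i) → sumFin f ≡ sumFin g
sum-cong {f = f} {g} f≗g =
  trans (sumFin≡sum f) (trans (Sum.sum-cong-≗ f≗g) (sym (sumFin≡sum g)))

sum-+ : ∀ {k} (f g : Fin k → ℚ) → sumFin (λ i → f i + g i) ≡ sumFin f + sumFin g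
sum-+ f g = trans (sumFin≡sum (λ i → f i + g i)) (trans (Sum.∑-distrib-+ f g)
  (sym (cong₂ _+_ (sumFin≡sum f) (sumFin≡sum g))))

sum-* : ∀ {k} a (f : Fin k → ℚ) → sumFin (λ i → a * f i) ≡ a * sumFin f
sum-* a f = trans (sumFin≡sum (λ i → a * f i)) (sym (trans (cong (a *_) (sumFin≡sum f))
  (ScaledSum.*-distribˡ-sum a f)))

sum-swap : ∀ {k l} (F : Fin k → Fin l → ℚ) →
  sumFin (λ i → sumFin (F i)) ≡ sumFin (λ j → sumFin (λ i → F i j))
sum-swap F = begin
  sumFin (λ i → sumFin (F i))             ≡⟨ sum-cong (λ i → sumFin≡sum (F i)) ⟩
  sumFin (λ i → Sum.sum (F i))            ≡⟨ sumFin≡sum (λ i → Sum.sum (F i)) ⟩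
  Sum.sum (λ i → Sum.sum (F i))           ≡⟨ Sum.∑-comm F ⟩
  Sum.sum (λ j → Sum.sum (λ i → F i j))   ≡⟨ sumFin≡sum (λ j → Sum.sum (λ i → F i j)) ⟨
  sumFin (λ j → Sum.sum (λ i → F i j))    ≡⟨ sum-cong (λ j → sumFin≡sum (λ i → F i j)) ⟨
  sumFin (λ j → sumFin (λ i → F i j))     ∎
  where open ≡-Reasoning

sum-0 : ∀ {k} {f : Fin k → ℚ} → (∀ i → f i ≡ 0ℚ) → sumFin f ≡ 0ℚ
sum-0 {k} f≗0 = trans (sum-cong f≗0) (trans (sumFin≡sum {k} (λ _ → 0ℚ)) (Sum.sum-replicate-zero k))

sum-single : ∀ {k} (f : Fin k → ℚ) b → (∀ i → i ≢ b → f i ≡ 0ℚ) → sumFin f ≡ f b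
sum-single f zero    f≗0 = trans (cong (f zero +_) (sum-0 (λ i → f≗0 (suc i) λ ())))
  (ℚ.+-identityʳ (f zero))
sum-single f (suc b) f≗0 = trans
  (cong₂ _+_ (f≗0 zero λ ())
    (sum-single (f ∘ suc) b (λ i i≢b → f≗0 (suc i) (i≢b ∘ Fin.suc-injective))))
  (ℚ.+-identityˡ (f (suc b)))

sum-nonNeg : ∀ {k} (f : Fin k → ℚ) → (∀ i → 0ℚ ≤ℚ f i) → 0ℚ ≤ℚ sumFin f
sum-nonNeg {zero}  f 0≤f = ℚ.≤-refl
sum-nonNeg {suc k} f 0≤f = ℚ.+-mono-≤ (0≤f zero) (sum-nonNeg (f ∘ suc) (0≤f ∘ suc))

sum-pos : ∀ {k} (f : Fin k → ℚ) → (∀ i → 0ℚ ≤ℚ f i) → ∀ b → 0ℚ <ℚ f b → 0ℚ <ℚ sumFin f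
sum-pos f 0≤f zero    0<fb = ℚ.+-mono-<-≤ 0<fb (sum-nonNeg (f ∘ suc) (0≤f ∘ suc))
sum-pos f 0≤f (suc b) 0<fb = ℚ.+-mono-≤-< (0≤f zero) (sum-pos (f ∘ suc) (0≤f ∘ suc) b 0<fb)

δ : ∀ {k} → Fin k → Fin k → ℚ
δ a b = if ⌊ a ≟ b ⌋ then 1ℚ else 0ℚ

δ-≡ : ∀ {k} (a : Fin k) → δ a a ≡ 1ℚ
δ-≡ a with a ≟ a
... | yes _   = refl
... | no  a≢a = contradiction refl a≢a

δ-≢ : ∀ {k} {a b : Fin k} → a ≢ b → δ a b ≡ 0ℚ
δ-≢ {a = a} {b} a≢b with a ≟ b
... | yes a≡b = contradiction a≡b a≢b
... | no  _   = refl

sum-δˡ : ∀ {k} (w : Fin k → ℚ) b → sumFin (λ a → w a * δ a b) ≡ w b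
sum-δˡ w b = trans
  (sum-single _ b (λ i i≢b → trans (cong (w i *_) (δ-≢ i≢b)) (ℚ.*-zeroʳ (w i))))
  (trans (cong (w b *_) (δ-≡ b)) (ℚ.*-identityʳ (w b)))

-- Ratio test

argmin : ∀ {k} {P : Fin k → Set} → Decidable P → (r : Fin k → ℚ) → ∃ P →
  ∃[ g ] P g × (∀ e → P e → r g ≤ℚ r e)
argmin {zero}  P? r (() , _)
argmin {suc k} {P} P? r (g₀ , Pg₀) with P? zero | Fin.any? (P? ∘ suc)
... | yes P0 | no ¬Ps =
  zero , P0 , λ { zero _ → ℚ.≤-refl ; (suc e) Pe → contradiction (e , Pe) ¬Ps }
... | no ¬P0 | no ¬Ps = contradiction Pg₀ (none g₀)
  where
  none : ∀ e → ¬ P e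
  none zero    = ¬P0
  none (suc e) = λ Pe → ¬Ps (e , Pe)
... | P0? | yes Ps with argmin (P? ∘ suc) (r ∘ suc) Ps
...   | g , Pg , min with P0?
...     | no ¬P0 = suc g , Pg , λ { zero P0 → contradiction P0 ¬P0 ; (suc e) → min e }
...     | yes P0 with ℚ.≤-total (r zero) (r (suc g))
...       | inj₁ le = zero , P0 , λ { zero _ → ℚ.≤-refl ; (suc e) Pe → ℚ.≤-trans le (min e Pe) }
...       | inj₂ ge = suc g , Pg , λ { zero _ → ge ; (suc e) → min e }

-- Total, with the default `0ℚ` at zero, so that the ratio test can write a quotient for every edge;
-- the values that matter come from non-zero arguments.
recip : ℚ → ℚ
recip q with q ℚ.≟ 0ℚ
... | yes _   = 0ℚ
... | no  q≢0 = (1/ q) {{≢-nonZero q≢0}}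

recip-inverse : ∀ {q} → q ≢ 0ℚ → recip q * q ≡ 1ℚ
recip-inverse {q} q≢0 with q ℚ.≟ 0ℚ
... | yes q≡0  = contradiction q≡0 q≢0
... | no  q≢0′ = ℚ.*-inverseˡ q {{≢-nonZero q≢0′}}

neg<0⇒pos : ∀ {q} → q <ℚ 0ℚ → 0ℚ <ℚ - q
neg<0⇒pos q<0 = ℚ.neg-antimono-< q<0

*-nonNeg : ∀ {p q} → 0ℚ ≤ℚ p → 0ℚ ≤ℚ q → 0ℚ ≤ℚ p * q
*-nonNeg {p} {q} 0≤p 0≤q =
  ℚ.nonNegative⁻¹ _ {{ℚ.nonNeg*nonNeg⇒nonNeg p {{nonNegative 0≤p}} q {{nonNegative 0≤q}}}}

*-cancel : ∀ t d → t * - d + t * d ≡ 0ℚ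
*-cancel t d = trans (sym (ℚ.*-distribˡ-+ t (- d) d))
  (trans (cong (t *_) (ℚ.+-inverseˡ d)) (ℚ.*-zeroʳ t))

-- Where `d e` is negative, `c e + t * d e` stays non-negative exactly while `t` is at most
-- `c e / (- d e)`. So `t` is the least of these ratios, and `g` an index attaining it. Elsewhere
-- `0 ≤ t` suffices.
ratio-test : ∀ {k} (c d : Fin k → ℚ) → (∀ e → 0ℚ ≤ℚ c e) → ∃[ e ] d e <ℚ 0ℚ →
  ∃[ t ] ∃[ g ] d g <ℚ 0ℚ × (∀ e → 0ℚ ≤ℚ c e + t * d e) × c g + t * d g ≡ 0ℚ
ratio-test c d 0≤c d<0 = ratio g , g , dg<0 , bound , exact
  where
  ratio : _ → ℚ
  ratio e = c e * recip (- d e)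

  d≢0 : ∀ {e} → d e <ℚ 0ℚ → - d e ≢ 0ℚ
  d≢0 de<0 -de≡0 = ℚ.<⇒≢ (neg<0⇒pos de<0) (sym -de≡0)

  ratio-* : ∀ {e} → d e <ℚ 0ℚ → ratio e * - d e ≡ c e
  ratio-* {e} de<0 = trans (ℚ.*-assoc (c e) (recip (- d e)) (- d e))
    (trans (cong (c e *_) (recip-inverse (d≢0 de<0))) (ℚ.*-identityʳ (c e)))

  minimal = argmin (λ e → d e ℚ.<? 0ℚ) ratio d<0
  g = proj₁ minimal
  dg<0 = proj₁ (proj₂ minimal)

  exact : c g + ratio g * d g ≡ 0ℚ
  exact = trans (cong (_+ ratio g * d g) (sym (ratio-* dg<0))) (*-cancel (ratio g) (d g))

  0≤ratio : 0ℚ ≤ℚ ratio g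
  0≤ratio = ℚ.*-cancelʳ-≤-pos (- d g) {{positive (neg<0⇒pos dg<0)}}
    (ℚ.≤-trans (ℚ.≤-reflexive (ℚ.*-zeroˡ (- d g)))
      (ℚ.≤-trans (0≤c g) (ℚ.≤-reflexive (sym (ratio-* dg<0)))))

  bound : ∀ e → 0ℚ ≤ℚ c e + ratio g * d e
  bound e with d e ℚ.<? 0ℚ
  ... | no  de≮0 = ℚ.+-mono-≤ (0≤c e) (*-nonNeg 0≤ratio (ℚ.≮⇒≥ de≮0))
  ... | yes de<0 = ℚ.≤-trans (ℚ.≤-reflexive (sym (*-cancel (ratio g) (d e))))
    (ℚ.+-monoˡ-≤ (ratio g * d e) (ℚ.≤-trans
      (ℚ.*-monoʳ-≤-nonNeg (- d e) {{nonNegative (ℚ.<⇒≤ (neg<0⇒pos de<0))}}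
        (proj₂ (proj₂ minimal) e de<0))
      (ℚ.≤-reflexive (ratio-* de<0))))

-- Flows and cuts

not-both : ∀ {b : Bool} {A : Set} → b ≡ true → b ≡ false → A
not-both refl ()

isYes-true : ∀ {A : Set} (a? : Dec A) → A → ⌊ a? ⌋ ≡ true
isYes-true (yes _) a = refl
isYes-true (no ¬a) a = contradiction a ¬a

isYes-false : ∀ {A : Set} (a? : Dec A) → ¬ A → ⌊ a? ⌋ ≡ false
isYes-false (yes a) ¬a = contradiction a ¬a
isYes-false (no _)  ¬a = refl

module Graph {m n k : ℕ} (G : BipartiteGraph m n k) where
  open BipartiteGraph G

  emN viN : Fin k → Node m n
  emN e = inj₁ (em e)
  viN e = inj₂ (vi e)

  _≟N_ : (x y : Node m n) → Dec (x ≡ y)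
  _≟N_ = Sum⊎.≡-dec _≟_ _≟_

  other-inc : ∀ {x} e → Inc G x e → Inc G (other G x e) e
  other-inc e (inj₁ refl) = inj₂ refl
  other-inc e (inj₂ refl) = inj₁ refl

  other-involutive : ∀ {x} e → Inc G x e → other G (other G x e) e ≡ x
  other-involutive e (inj₁ refl) = refl
  other-involutive e (inj₂ refl) = refl

  endpoints : ∀ {x y e} → Inc G x e → Inc G y e → y ≡ x ⊎ y ≡ other G x e
  endpoints (inj₁ refl) (inj₁ refl) = inj₁ refl
  endpoints (inj₁ refl) (inj₂ refl) = inj₂ refl
  endpoints (inj₂ refl) (inj₁ refl) = inj₂ refl
  endpoints (inj₂ refl) (inj₂ refl) = inj₁ refl

  insert : EdgeSet G → Fin k → EdgeSet G
  insert S e f = if ⌊ f ≟ e ⌋ then true else S f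

  remove-≡ : ∀ S e → remove G S e e ≡ false
  remove-≡ S e with e ≟ e
  ... | yes _   = refl
  ... | no  e≢e = contradiction refl e≢e

  remove-≢ : ∀ S {e f} → f ≢ e → remove G S e f ≡ S f
  remove-≢ S {e} {f} f≢e with f ≟ e
  ... | yes f≡e = contradiction f≡e f≢e
  ... | no  _   = refl

  remove-∈ : ∀ S e f → remove G S e f ≡ true → f ≢ e × S f ≡ true
  remove-∈ S e f f∈ with f ≟ e
  remove-∈ S e f () | yes _
  remove-∈ S e f f∈ | no f≢e = f≢e , f∈

  insert-≡ : ∀ S e → insert S e e ≡ true
  insert-≡ S e with e ≟ e
  ... | yes _   = refl
  ... | no  e≢e = contradiction refl e≢e

  insert-≢ : ∀ S {e f} → f ≢ e → insert S e f ≡ S f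
  insert-≢ S {e} {f} f≢e with f ≟ e
  ... | yes f≡e = contradiction f≡e f≢e
  ... | no  _   = refl

  Reach-trans : ∀ {S x y z} → Reach G S x y → Reach G S y z → Reach G S x z
  Reach-trans here             s = s
  Reach-trans (step e∈S inc r) s = step e∈S inc (Reach-trans r s)

  Reach-back : ∀ {S x} e → S e ≡ true → Inc G x e → Reach G S (other G x e) x
  Reach-back {S} e e∈S inc = step e∈S (other-inc e inc)
    (subst (λ y → Reach G S y _) (sym (other-involutive e inc)) here)

  Reach-sym : ∀ {S x y} → Reach G S x y → Reach G S y x
  Reach-sym here                     = here
  Reach-sym (step {e = e} e∈S inc r) = Reach-trans (Reach-sym r) (Reach-back e e∈S inc)

  Reach-map : ∀ {S S′ x y} → (∀ e → S e ≡ true → Reach G S′ (emN e) (viN e)) →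
    Reach G S x y → Reach G S′ x y
  Reach-map h here                                 = here
  Reach-map h (step {e = e} e∈S (inj₁ refl) r) = Reach-trans (h e e∈S) (Reach-map h r)
  Reach-map h (step {e = e} e∈S (inj₂ refl) r) =
    Reach-trans (Reach-sym (h e e∈S)) (Reach-map h r)

  edge-reach : ∀ {S e} → S e ≡ true → Reach G S (emN e) (viN e)
  edge-reach e∈S = step e∈S (inj₁ refl) here

  Respects : {A : Set} → EdgeSet G → (Node m n → A) → Set
  Respects S χ = ∀ e → S e ≡ true → χ (emN e) ≡ χ (viN e)

  Reach-respects : ∀ {A : Set} {S} {χ : Node m n → A} → Respects S χ →
    ∀ {x y} → Reach G S x y → χ x ≡ χ y
  Reach-respects resp here                                     = refl
  Reach-respects {χ = χ} resp (step {e = e} e∈S (inj₁ refl) r) =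
    trans (resp e e∈S) (Reach-respects {χ = χ} resp r)
  Reach-respects {χ = χ} resp (step {e = e} e∈S (inj₂ refl) r) =
    trans (sym (resp e e∈S)) (Reach-respects {χ = χ} resp r)

  -- Union-find along the list of edges: each node carries a representative, and an edge of `S`
  -- merges the labels of its ends. With all edges listed, equality of labels decides `Reach`.
  component-labels : ∀ S (es : List (Fin k)) → Σ[ lab ∈ (Node m n → Node m n) ]
    (∀ x y → lab x ≡ lab y → Reach G S x y) ×
    (∀ e → e ∈ es → S e ≡ true → lab (emN e) ≡ lab (viN e))
  component-labels S [] = (λ x → x) , (λ { x .x refl → here }) , λ _ ()
  component-labels S (f ∷ es) with component-labels S es | S f in f∈?
  ... | lab , sound , complete | false = lab , sound ,
    λ { e (here refl) e∈S → not-both e∈S f∈? ; e (there e∈) e∈S → complete e e∈ e∈S }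
  ... | lab , sound , complete | true = lab′ , sound′ ,
    λ { e (here refl) _ → joined ; e (there e∈) e∈S → cong merge (complete e e∈ e∈S) }
    where
    merge : Node m n → Node m n
    merge l = if ⌊ l ≟N lab (emN f) ⌋ then lab (viN f) else l

    lab′ : Node m n → Node m n
    lab′ x = merge (lab x)

    f-reach : Reach G S (emN f) (viN f)
    f-reach = edge-reach f∈?

    joined : lab′ (emN f) ≡ lab′ (viN f)
    joined with lab (emN f) ≟N lab (emN f) | lab (viN f) ≟N lab (emN f)
    ... | yes _ | yes _ = refl
    ... | yes _ | no  _ = refl
    ... | no  ≢ | _     = contradiction refl ≢

    sound′ : ∀ x y → lab′ x ≡ lab′ y → Reach G S x y
    sound′ x y eq with lab x ≟N lab (emN f) | lab y ≟N lab (emN f)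
    ... | yes p | yes q = sound x y (trans p (sym q))
    ... | yes p | no  _ = Reach-trans (sound _ _ p) (Reach-trans f-reach (sound _ _ eq))
    ... | no  _ | yes q =
      Reach-trans (sound _ _ eq) (Reach-trans (Reach-sym f-reach) (sound _ _ (sym q)))
    ... | no  _ | no  _ = sound x y eq

  -- `χ` marks a union of components of `S` that separates the ends of `g`. Putting the emerald end
  -- on the `true` side fixes which crossing edges run in the direction of `g`. For
  -- `S = remove G T g` with `T` a tree this is the fundamental cut of `g`.
  record Cut (S : EdgeSet G) (g : Fin k) (χ : Node m n → Bool) : Set where
    field
      em-side  : χ (emN g) ≡ true
      vi-side  : χ (viN g) ≡ false
      respects : Respects S χ

    ends-differ : χ (emN g) ≢ χ (viN g)
    ends-differ eq = not-both (trans (sym eq) em-side) vi-side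

  -- In the negative case the cut is the component of `emN g`, namely the nodes with its label. A
  -- colouring is easier to work with than the absence of walks.
  reach-or-cut : ∀ S g → Reach G S (emN g) (viN g) ⊎ ∃ (Cut S g)
  reach-or-cut S g with component-labels S (allFin k)
  ... | lab , sound , complete with lab (emN g) ≟N lab (viN g)
  ...   | yes eq = inj₁ (sound _ _ eq)
  ...   | no  ne = inj₂ (χ , record { em-side = em-side ; vi-side = vi-side ; respects =
      λ e e∈S → cong (λ l → ⌊ l ≟N lab (emN g) ⌋) (complete e (∈-allFin e) e∈S) })
    where
    χ : Node m n → Bool
    χ x = ⌊ lab x ≟N lab (emN g) ⌋

    em-side : χ (emN g) ≡ true
    em-side = isYes-true (lab (emN g) ≟N lab (emN g)) refl

    vi-side : χ (viN g) ≡ false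
    vi-side = isYes-false (lab (viN g) ≟N lab (emN g)) (ne ∘ sym)

  fundamental-cut : ∀ {T g} → SpanningTree G T → T g ≡ true → ∃ (Cut (remove G T g) g)
  fundamental-cut {T} {g} (_ , acyclic) g∈T with reach-or-cut (remove G T g) g
  ... | inj₁ r   = contradiction r (acyclic g g∈T)
  ... | inj₂ cut = cut

  -- The unsigned incidence map, sending coefficients to the point that they represent. Negating one
  -- colour class turns it into the boundary map of a directed graph, so its kernel `Balanced`
  -- consists of the circulations.
  ∂ : (Fin k → ℚ) → Node m n → ℚ
  ∂ d x = sumFin (λ e → d e * indicator G x e)

  ∂-affine : ∀ c t d x → ∂ (λ e → c e + t * d e) x ≡ ∂ c x + t * ∂ d x
  ∂-affine c t d x = trans
    (sum-cong (λ e → distrib (c e) t (d e) (indicator G x e)))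
    (trans (sum-+ _ (λ e → t * (d e * indicator G x e)))
      (cong (∂ c x +_) (sum-* t (λ e → d e * indicator G x e))))
    where
    open Data.Rational.Solver.+-*-Solver
    distrib : ∀ c t d i → (c + t * d) * i ≡ c * i + t * (d * i)
    distrib = solve 4 (λ c t d i → (c :+ t :* d) :* i := c :* i :+ t :* (d :* i)) refl

  Balanced : (Fin k → ℚ) → Set
  Balanced d = ∀ x → ∂ d x ≡ 0ℚ

  -- A weight `w` on one colour class is a combination of the functions `δ a`, and for these the
  -- claim is balance at the node `a`.
  endpoint-sum : ∀ {l} (end : Fin k → Fin l) (d : Fin k → ℚ) →
    (∀ a → sumFin (λ e → d e * δ a (end e)) ≡ 0ℚ) →
    ∀ w → sumFin (λ e → d e * w (end e)) ≡ 0ℚ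
  endpoint-sum end d balanced w = begin
    sumFin (λ e → d e * w (end e))
      ≡⟨ sum-cong (λ e → cong (d e *_) (sum-δˡ w (end e))) ⟨
    sumFin (λ e → d e * sumFin (λ a → w a * δ a (end e)))
      ≡⟨ sum-cong (λ e → sum-* (d e) (λ a → w a * δ a (end e))) ⟨
    sumFin (λ e → sumFin (λ a → d e * (w a * δ a (end e))))
      ≡⟨ sum-swap (λ e a → d e * (w a * δ a (end e))) ⟩
    sumFin (λ a → sumFin (λ e → d e * (w a * δ a (end e))))
      ≡⟨ sum-cong (λ a → trans (sum-cong (λ e → rotate (d e) (w a) (δ a (end e))))
                                (sum-* (w a) (λ e → d e * δ a (end e)))) ⟩
    sumFin (λ a → w a * sumFin (λ e → d e * δ a (end e)))
      ≡⟨ sum-0 (λ a → trans (cong (w a *_) (balanced a)) (ℚ.*-zeroʳ (w a))) ⟩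
    0ℚ ∎
    where
    open ≡-Reasoning
    open Data.Rational.Solver.+-*-Solver using (solve; _:*_; _:=_)
    rotate : ∀ a b c → a * (b * c) ≡ b * (a * c)
    rotate = solve 3 (λ a b c → a :* (b :* c) := b :* (a :* c)) refl

  -- Every edge has exactly one emerald end, so the weight 1 on emerald nodes counts each edge once.
  Balanced-sum : ∀ {d} → Balanced d → sumFin d ≡ 0ℚ
  Balanced-sum {d} balanced = trans
    (sum-cong {g = λ e → d e * 1ℚ} (λ e → sym (ℚ.*-identityʳ (d e))))
    (endpoint-sum em d (balanced ∘ inj₁) (λ _ → 1ℚ))

  bit : Bool → ℚ
  bit b = if b then 1ℚ else 0ℚ

  -- The net flow of d across χ vanishes.
  no-one-way-flow : ∀ {d} → Balanced d → (χ : Node m n → Bool) →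
    (∀ e → χ (emN e) ≡ true → χ (viN e) ≡ false → d e ≤ℚ 0ℚ) →
    (∀ e → χ (emN e) ≡ false → χ (viN e) ≡ true → 0ℚ ≤ℚ d e) →
    ∀ g → χ (emN g) ≡ true → χ (viN g) ≡ false → ¬ (d g <ℚ 0ℚ)
  no-one-way-flow {d} balanced χ out in′ g em-side vi-side dg<0 =
    ℚ.<-irrefl (sym total) (sum-pos net net≥0 g net>0)
    where
    -- An edge within one side contributes 0, an edge with only its emerald end on the `true` side
    -- `- d e`, an edge with only its violet end there `d e`. By the hypotheses no term is negative,
    -- and the term of `g` is positive.
    net : Fin k → ℚ
    net e = d e * bit (χ (viN e)) + d e * (- bit (χ (emN e)))

    total : sumFin net ≡ 0ℚ
    total = trans (sum-+ (λ e → d e * bit (χ (viN e))) _) (cong₂ _+_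
      (endpoint-sum vi d (balanced ∘ inj₂) (bit ∘ χ ∘ inj₂))
      (endpoint-sum em d (balanced ∘ inj₁) (-_ ∘ bit ∘ χ ∘ inj₁)))

    same : ∀ q b → q * b + q * - b ≡ 0ℚ
    same q b = trans (ℚ.+-comm (q * b) (q * - b)) (*-cancel q b)
    emerald : ∀ q → q * 0ℚ + q * - 1ℚ ≡ - q
    emerald q = trans (cong₂ _+_ (ℚ.*-zeroʳ q) (sym (ℚ.neg-distribʳ-* q 1ℚ)))
      (trans (ℚ.+-identityˡ _) (cong -_ (ℚ.*-identityʳ q)))
    violet : ∀ q → q * 1ℚ + q * - 0ℚ ≡ q
    violet q = trans (cong₂ _+_ (ℚ.*-identityʳ q) (ℚ.*-zeroʳ q)) (ℚ.+-identityʳ q)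

    net≥0 : ∀ e → 0ℚ ≤ℚ net e
    net≥0 e with χ (emN e) in eq₁ | χ (viN e) in eq₂
    ... | true  | true  = ℚ.≤-reflexive (sym (same (d e) 1ℚ))
    ... | false | false = ℚ.≤-reflexive (sym (same (d e) 0ℚ))
    ... | true  | false = ℚ.≤-trans (ℚ.neg-antimono-≤ (out e eq₁ eq₂))
      (ℚ.≤-reflexive (sym (emerald (d e))))
    ... | false | true  = ℚ.≤-trans (in′ e eq₁ eq₂) (ℚ.≤-reflexive (sym (violet (d e))))

    net>0 : 0ℚ <ℚ net g
    net>0 rewrite em-side | vi-side =
      ℚ.<-≤-trans (neg<0⇒pos dg<0) (ℚ.≤-reflexive (sym (emerald (d g))))

  -- Flows along walks and cycles

  ι : Node m n → Node m n → ℚ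
  ι (inj₁ a) (inj₁ b) = δ a b
  ι (inj₂ u) (inj₂ v) = δ u v
  ι (inj₁ _) (inj₂ _) = 0ℚ
  ι (inj₂ _) (inj₁ _) = 0ℚ

  indicator-ι : ∀ z e → indicator G z e ≡ ι z (emN e) + ι z (viN e)
  indicator-ι (inj₁ a) e = sym (ℚ.+-identityʳ _)
  indicator-ι (inj₂ v) e = sym (ℚ.+-identityˡ _)

  sgn : Node m n → ℚ
  sgn (inj₁ _) = - 1ℚ
  sgn (inj₂ _) = 1ℚ

  -- Alternating along the walk, so that the boundaries cancel at interior nodes.
  walk-flow : ∀ {S x y} → Reach G S x y → Fin k → ℚ
  walk-flow here                     f = 0ℚ
  walk-flow (step {x} {e = e} _ _ r) f = walk-flow r f + sgn x * δ f e

  ∂-δ : ∀ e z → ∂ (λ f → δ f e) z ≡ indicator G z e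
  ∂-δ e z = trans (sum-cong (λ f → ℚ.*-comm (δ f e) (indicator G z f))) (sum-δˡ (indicator G z) e)

  -- `sgn` flips along every edge, so a step from `x` to a neighbour `y` has boundary
  -- `sgn x * (ι z x + ι z y)`, which is `sgn x * ι z x` minus `sgn y * ι z y`; such differences
  -- telescope.
  ∂-walk-flow : ∀ {S x y} (r : Reach G S x y) z →
    ∂ (walk-flow r) z ≡ sgn x * ι z x + - (sgn y * ι z y)
  ∂-walk-flow (here {x = x}) z = trans
    (sum-0 (λ e → ℚ.*-zeroˡ (indicator G z e))) (sym (ℚ.+-inverseʳ (sgn x * ι z x)))
  ∂-walk-flow {x = x} {y} (step {e = e} _ inc r) z = trans
    (∂-affine (walk-flow r) (sgn x) (λ f → δ f e) z)
    (trans (cong₂ (λ a b → a + sgn x * b) (∂-walk-flow r z) (trans (∂-δ e z) (indicator-ι z e)))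
      (telescope inc))
    where
    open Data.Rational.Solver.+-*-Solver
    telescope : ∀ {x} → Inc G x e →
      (sgn (other G x e) * ι z (other G x e) + - (sgn y * ι z y))
          + sgn x * (ι z (emN e) + ι z (viN e))
        ≡ sgn x * ι z x + - (sgn y * ι z y)
    -- `1ℚ` is passed as the variable `s`, so that the two signs become `s` and `:- s`.
    telescope (inj₁ refl) = solve 4 (λ s a v w →
        (s :* v :+ (:- w)) :+ (:- s) :* (a :+ v) := (:- s) :* a :+ (:- w))
      refl 1ℚ (ι z (emN e)) (ι z (viN e)) (sgn y * ι z y)
    telescope (inj₂ refl) = solve 4 (λ s a v w →
        ((:- s) :* a :+ (:- w)) :+ s :* (a :+ v) := s :* v :+ (:- w))
      refl 1ℚ (ι z (emN e)) (ι z (viN e)) (sgn y * ι z y)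

  walk-flow-support : ∀ {S x y} (r : Reach G S x y) f → S f ≡ false → walk-flow r f ≡ 0ℚ
  walk-flow-support here f f∉S = refl
  walk-flow-support (step {x} {e = e} e∈S _ r) f f∉S = cong₂ _+_ (walk-flow-support r f f∉S)
    (trans (cong (sgn x *_) (δ-≢ λ { refl → not-both e∈S f∉S })) (ℚ.*-zeroʳ (sgn x)))

  -- The boundary of the walk is minus that of the single edge `f`, so one unit of `f` closes the
  -- cycle. The walk avoids `f`, which leaves the coefficient of `f` at 1.
  cycle-flow : ∀ S f → Reach G (remove G S f) (emN f) (viN f) → S f ≡ true →
    ∃[ d ] Balanced d × (∀ e → S e ≡ false → d e ≡ 0ℚ) × d f ≡ 1ℚ
  cycle-flow S f r f∈S = d , balanced , support , df≡1
    where
    d : Fin k → ℚ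
    d e = walk-flow r e + 1ℚ * δ e f

    open Data.Rational.Solver.+-*-Solver
    cancel : ∀ a v → (- 1ℚ * a + - (1ℚ * v)) + 1ℚ * (a + v) ≡ 0ℚ
    cancel a v = trans (solve 3 (λ s a v →
        ((:- s) :* a :+ (:- (s :* v))) :+ s :* (a :+ v) := a :* (:- s) :+ a :* s)
      refl 1ℚ a v) (*-cancel a 1ℚ)

    balanced : Balanced d
    balanced z = trans (∂-affine (walk-flow r) 1ℚ (λ e → δ e f) z)
      (trans (cong₂ (λ a b → a + 1ℚ * b) (∂-walk-flow r z) (trans (∂-δ f z) (indicator-ι z f)))
        (cancel (ι z (emN f)) (ι z (viN f))))

    support : ∀ e → S e ≡ false → d e ≡ 0ℚ
    support e e∉S = cong₂ _+_
      (walk-flow-support r e (trans (remove-≢ S e≢f) e∉S))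
      (trans (ℚ.*-identityˡ (δ e f)) (δ-≢ e≢f))
      where
      e≢f : e ≢ f
      e≢f refl = not-both f∈S e∉S

    df≡1 : d f ≡ 1ℚ
    df≡1 = trans (cong₂ _+_ (walk-flow-support r f (remove-≡ S f)) (ℚ.*-identityˡ (δ f f)))
      (trans (ℚ.+-identityˡ (δ f f)) (δ-≡ f))

  -- A negative coordinate of a balanced d lies on a cycle of the support.
  remove-connected : ∀ {S d g} → Balanced d → (∀ e → S e ≡ false → d e ≡ 0ℚ) → d g <ℚ 0ℚ →
    ConnectedSub G S → ConnectedSub G (remove G S g)
  remove-connected {S} {d} {g} balanced support dg<0 conn x y
    with reach-or-cut (remove G S g) g
  ... | inj₁ r = Reach-map reroute (conn x y)
    where
    reroute : ∀ e → S e ≡ true → Reach G (remove G S g) (emN e) (viN e)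
    reroute e e∈S with e ≟ g
    ... | yes refl = r
    ... | no  e≢g  = edge-reach (trans (remove-≢ S e≢g) e∈S)
  -- Otherwise `g` would be the only edge of the support across the cut, and its flow could not be
  -- compensated.
  ... | inj₂ (χ , cut) = contradiction dg<0 (no-one-way-flow balanced χ out in′ g em-side vi-side)
    where
    open Cut cut
    crossing : ∀ e → χ (emN e) ≢ χ (viN e) → e ≢ g → d e ≡ 0ℚ
    crossing e crosses e≢g = support e (trans (sym (remove-≢ S e≢g))
      (¬-not (crosses ∘ respects e)))

    out : ∀ e → χ (emN e) ≡ true → χ (viN e) ≡ false → d e ≤ℚ 0ℚ
    out e eq₁ eq₂ with e ≟ g
    ... | yes refl = ℚ.<⇒≤ dg<0
    ... | no  e≢g  = ℚ.≤-reflexive (crossing e (λ eq → not-both (trans (sym eq) eq₁) eq₂) e≢g)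

    in′ : ∀ e → χ (emN e) ≡ false → χ (viN e) ≡ true → 0ℚ ≤ℚ d e
    in′ e eq₁ eq₂ = ℚ.≤-reflexive (sym (crossing e (λ eq → not-both (trans eq eq₂) eq₁)
      λ { refl → not-both em-side eq₁ }))

  -- Exchanging edges

  Supported : EdgeSet G → (Fin k → ℚ) → Set
  Supported S c = ∀ e → S e ≡ false → c e ≡ 0ℚ

  -- Moving along a balanced `d` changes neither the represented point nor, by `Balanced-sum`, the
  -- total of the coefficients.
  shift-combination : ∀ {c d p} t → IsCombination G c p → Balanced d →
    (∀ e → 0ℚ ≤ℚ c e + t * d e) → IsCombination G (λ e → c e + t * d e) p
  shift-combination {c} {d} {p} t (_ , c-total , c-point) balanced nonNeg = nonNeg , total , point
    where
    absorb : ∀ q {z} → z ≡ 0ℚ → q + t * z ≡ q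
    absorb q refl = trans (cong (q +_) (ℚ.*-zeroʳ t)) (ℚ.+-identityʳ q)

    total : sumFin (λ e → c e + t * d e) ≡ 1ℚ
    total = trans (sum-+ c (λ e → t * d e)) (trans (cong (sumFin c +_) (sum-* t d))
      (trans (absorb (sumFin c) (Balanced-sum balanced)) c-total))

    point : ∀ x → p x ≡ ∂ (λ e → c e + t * d e) x
    point x = trans (c-point x)
      (sym (trans (∂-affine c t d x) (absorb (∂ c x) (balanced x))))

  Supported-shift : ∀ {S c d g} t → Supported S c → Supported S d → c g + t * d g ≡ 0ℚ →
    Supported (remove G S g) (λ e → c e + t * d e)
  Supported-shift {S} {g = g} t c-supp d-supp cancels e e∉ with e ≟ g
  ... | yes refl = cancels
  ... | no  e≢g  = trans (cong₂ (λ a b → a + t * b) (c-supp e e∉) (d-supp e e∉))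
    (trans (ℚ.+-identityˡ (t * 0ℚ)) (ℚ.*-zeroʳ t))

  -- The coefficients of a balanced vector sum to zero, so the 1 at `f` must be compensated.
  has-negative : ∀ {d f} → Balanced d → d f ≡ 1ℚ → ∃[ e ] d e <ℚ 0ℚ
  has-negative {d} {f} balanced df≡1 with Fin.any? (λ e → d e ℚ.<? 0ℚ)
  ... | yes neg = neg
  ... | no ¬neg = contradiction (Balanced-sum balanced) (ℚ.<⇒≢
    (sum-pos d (λ e → ℚ.≮⇒≥ (λ de<0 → ¬neg (e , de<0))) f
      (subst (0ℚ <ℚ_) (sym df≡1) (ℚ.positive⁻¹ 1ℚ))) ∘ sym)

  abstract
    -- Coefficients of `p` are pushed along a cycle through `f` until one of them vanishes. This
    -- serves both to thin out a graph with cycles and to pivot between trees; the pivot also reads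
    -- off the direction of `f` from the signs of `d`, hence `d` is returned.
    exchange : ∀ {S p f} → ConnectedSub G S → InQT G S p →
      S f ≡ true → Reach G (remove G S f) (emN f) (viN f) →
      ∃[ g ] (∃[ d ] Balanced d × Supported S d × d f ≡ 1ℚ × d g <ℚ 0ℚ) ×
        S g ≡ true × ConnectedSub G (remove G S g) × InQT G (remove G S g) p
    exchange {S} {p} {f} conn (c , comb , c-supp) f∈S r = cancel (cycle-flow S f r f∈S)
      where
      Exchange : Set
      Exchange = ∃[ g ] (∃[ d ] Balanced d × Supported S d × d f ≡ 1ℚ × d g <ℚ 0ℚ) ×
        S g ≡ true × ConnectedSub G (remove G S g) × InQT G (remove G S g) p

      drop : ∀ {d} → Balanced d → Supported S d → d f ≡ 1ℚ →
        ∃[ t ] ∃[ g ] d g <ℚ 0ℚ × (∀ e → 0ℚ ≤ℚ c e + t * d e) × c g + t * d g ≡ 0ℚ → Exchange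
      drop {d} balanced d-supp df≡1 (t , g , dg<0 , c′≥0 , c′g≡0) =
        g , (d , balanced , d-supp , df≡1 , dg<0) ,
        ¬-not (λ g∉S → ℚ.<⇒≢ dg<0 (d-supp g g∉S)) ,
        remove-connected balanced d-supp dg<0 conn ,
        (λ e → c e + t * d e) , shift-combination t comb balanced c′≥0 ,
        Supported-shift t c-supp d-supp c′g≡0

      cancel : ∃[ d ] Balanced d × Supported S d × d f ≡ 1ℚ → Exchange
      cancel (d , balanced , d-supp , df≡1) = drop balanced d-supp df≡1
        (ratio-test c d (proj₁ comb) (has-negative {d} {f} balanced df≡1))

-- Tours

Least : (ℕ → Set) → ℕ → Set
Least P i = P i × (∀ j → j < i → ¬ P j)

least : ∀ {P} → Decidable P → ∀ {n} → P n → ∃[ i ] i ≤ n × Least P i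
least {P} P? {n} Pn = search n 0 (ℕ.+-identityʳ n) λ _ ()
  where
  search : ∀ fuel i → fuel ℕ.+ i ≡ n → (∀ j → j < i → ¬ P j) → ∃[ i ] i ≤ n × Least P i
  search fuel i eq below with P? i
  ... | yes Pi = i , subst (i ≤_) eq (ℕ.m≤n+m i fuel) , Pi , below
  search zero       i refl below | no ¬Pi = contradiction Pn ¬Pi
  search (suc fuel) i eq   below | no ¬Pi =
    search fuel (suc i) (trans (ℕ.+-suc fuel i) eq) below′
    where
    below′ : ∀ j → j < suc i → ¬ P j
    below′ j (s≤s j≤i) with ℕ.m≤n⇒m<n∨m≡n j≤i
    ... | inj₁ j<i  = below j j<i
    ... | inj₂ refl = ¬Pi

module _ {A : Set} (f : A → A) where

  iter-+ : ∀ i j a → iter f (i ℕ.+ j) a ≡ iter f i (iter f j a)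
  iter-+ zero    j a = refl
  iter-+ (suc i) j a = cong f (iter-+ i j a)

  iter-fixed : ∀ p {a} → iter f p a ≡ a → ∀ q → iter f (q ℕ.* p) a ≡ a
  iter-fixed p     fix zero    = refl
  iter-fixed p {a} fix (suc q) =
    trans (iter-+ p (q ℕ.* p) a) (trans (cong (iter f p) (iter-fixed p fix q)) fix)

  -- A repetition before time i could be cut out of the orbit.
  least-no-repeat : ∀ {a b i} → Least (λ j → iter f j a ≡ b) i →
    ∀ {j j′} → j < j′ → j′ ≤ i → iter f j a ≢ iter f j′ a
  least-no-repeat {a} {b} {i} (at , before) {j} {j′} j<j′ j′≤i eq =
    before (i ∸ j′ ℕ.+ j)
      (ℕ.<-≤-trans (ℕ.+-monoʳ-< (i ∸ j′) j<j′) (ℕ.≤-reflexive (ℕ.m∸n+n≡m j′≤i)))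
      (begin
        iter f (i ∸ j′ ℕ.+ j) a       ≡⟨ iter-+ (i ∸ j′) j a ⟩
        iter f (i ∸ j′) (iter f j a)  ≡⟨ cong (iter f (i ∸ j′)) eq ⟩
        iter f (i ∸ j′) (iter f j′ a) ≡⟨ iter-+ (i ∸ j′) j′ a ⟨
        iter f (i ∸ j′ ℕ.+ j′) a      ≡⟨ cong (λ t → iter f t a) (ℕ.m∸n+n≡m j′≤i) ⟩
        iter f i a                    ≡⟨ at ⟩
        b                             ∎)
    where open ≡-Reasoning

module Tours {m n k : ℕ} (G : BipartiteGraph m n k) (R : RibbonStructure G)
             (b₀ : Node m n) (b : Fin k) (b-inc : Inc G b₀ b) where
  open BipartiteGraph G
  open RibbonStructure R
  open Graph G

  Dart : Set
  Dart = Node m n × Fin k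

  IncDart : Dart → Set
  IncDart (x , e) = Inc G x e

  _≟D_ : (d d′ : Dart) → Dec (d ≡ d′)
  _≟D_ = Product.≡-dec _≟N_ _≟_

  next : EdgeSet G → Dart → Dart
  next = tourStep G R

  tour : EdgeSet G → ℕ → Dart
  tour T i = iter (next T) i (b₀ , b)

  next-∉ : ∀ {T x e} → T e ≡ false → next T (x , e) ≡ (x , ρ x e)
  next-∉ e∉T rewrite e∉T = refl

  next-∈ : ∀ {T x e} → T e ≡ true → next T (x , e) ≡ (other G x e , ρ (other G x e) e)
  next-∈ e∈T rewrite e∈T = refl

  next-cong : ∀ {T T′} d → T (proj₂ d) ≡ T′ (proj₂ d) → next T d ≡ next T′ d
  next-cong (x , e) eq rewrite eq = refl

  next-inc : ∀ T d → IncDart d → IncDart (next T d)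
  next-inc T (x , e) inc with T e
  ... | true  = ρ-inc (other G x e) e (other-inc e inc)
  ... | false = ρ-inc x e inc

  iter-inc : ∀ T i {d} → IncDart d → IncDart (iter (next T) i d)
  iter-inc T zero    inc = inc
  iter-inc T (suc i) inc = next-inc T _ (iter-inc T i inc)

  tour-inc : ∀ T i → IncDart (tour T i)
  tour-inc T i = iter-inc T i b-inc

  -- If `j` and `j′` steps lead from the common image `a` to `e` and to `f`, then `suc j` and
  -- `suc j′` are both periods of `a`. Padding each exponent with periods of its own makes both
  -- equal to `j + j′ + j * j′`.
  ρ-injective : ∀ x {e f} → Inc G x e → Inc G x f → ρ x e ≡ ρ x f → e ≡ f
  ρ-injective x {e} {f} e-inc f-inc eq
    with ρ-cyclic x (ρ x e) e (ρ-inc x e e-inc) e-inc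
       | ρ-cyclic x (ρ x e) f (ρ-inc x e e-inc) f-inc
  ... | j , to-e | j′ , to-f = begin
    e
      ≡⟨ to-e ⟨
    iter (ρ x) j a
      ≡⟨ cong (iter (ρ x) j) (iter-fixed (ρ x) (suc j) (cong (ρ x) to-e) j′) ⟨
    iter (ρ x) j (iter (ρ x) (j′ ℕ.* suc j) a)
      ≡⟨ iter-+ (ρ x) j _ a ⟨
    iter (ρ x) (j ℕ.+ j′ ℕ.* suc j) a
      ≡⟨ cong (λ t → iter (ρ x) t a) (same j j′) ⟩
    iter (ρ x) (j′ ℕ.+ j ℕ.* suc j′) a
      ≡⟨ iter-+ (ρ x) j′ _ a ⟩
    iter (ρ x) j′ (iter (ρ x) (j ℕ.* suc j′) a)
      ≡⟨ cong (iter (ρ x) j′)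
           (iter-fixed (ρ x) (suc j′) (trans (cong (ρ x) to-f) (sym eq)) j) ⟩
    iter (ρ x) j′ a
      ≡⟨ to-f ⟩
    f ∎
    where
    open ≡-Reasoning
    a = ρ x e
    same : ∀ j j′ → j ℕ.+ j′ ℕ.* suc j ≡ j′ ℕ.+ j ℕ.* suc j′
    same = solve-∀

  -- The new dart determines the previous edge, since `ρ` is injective at the new node; membership
  -- of that edge in `T` then tells whether the node has changed.
  next-injective : ∀ T d d′ → IncDart d → IncDart d′ → next T d ≡ next T d′ → d ≡ d′
  next-injective T (x , e) (x′ , e′) inc inc′ eq with T e in e∈ | T e′ in e′∈
  ... | false | false with refl ← cong proj₁ eq =
    cong (x ,_) (ρ-injective x inc inc′ (cong proj₂ eq))
  ... | true | true = cong₂ _,_ x≡x′ e≡e′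
    where
    y≡y′ : other G x e ≡ other G x′ e′
    y≡y′ = cong proj₁ eq

    e≡e′ : e ≡ e′
    e≡e′ = ρ-injective (other G x e) (other-inc e inc)
      (subst (λ y → Inc G y e′) (sym y≡y′) (other-inc e′ inc′))
      (trans (cong proj₂ eq) (cong (λ y → ρ y e′) (sym y≡y′)))

    x≡x′ : x ≡ x′
    x≡x′ = trans (sym (other-involutive e inc))
      (trans (cong₂ (other G) y≡y′ e≡e′) (other-involutive e′ inc′))
  ... | true | false with refl ← cong proj₁ eq = contradiction
    (trans (sym e∈)
      (trans (cong T (ρ-injective _ (other-inc e inc) inc′ (cong proj₂ eq))) e′∈)) λ ()
  ... | false | true with refl ← cong proj₁ eq = contradiction
    (trans (sym e∈)
      (trans (cong T (ρ-injective _ inc (other-inc e′ inc′) (cong proj₂ eq))) e′∈)) λ ()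

  iter-injective : ∀ T i {d d′} → IncDart d → IncDart d′ →
    iter (next T) i d ≡ iter (next T) i d′ → d ≡ d′
  iter-injective T zero    inc inc′ eq = eq
  iter-injective T (suc i) inc inc′ eq = iter-injective T i inc inc′
    (next-injective T _ _ (iter-inc T i inc) (iter-inc T i inc′) eq)

  -- All pairs of a node and an edge, incident or not: an upper bound on the number of darts, and
  -- the time horizon of the tours.
  dartCount : ℕ
  dartCount = (m ℕ.+ n) ℕ.* k

  encode : Dart → Fin dartCount
  encode (x , e) = combine (join m n x) e

  encode-injective : ∀ {d d′} → encode d ≡ encode d′ → d ≡ d′
  encode-injective {x , e} {x′ , e′} eq = cong₂ _,_
    (trans (sym (Fin.splitAt-join m n x))
      (trans (cong (splitAt m) (proj₁ parts)) (Fin.splitAt-join m n x′)))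
    (proj₂ parts)
    where parts = Fin.combine-injective (join m n x) e (join m n x′) e′ eq

  repeat : (s : ℕ → Dart) → ∃[ i ] ∃[ j ] i < j × j ≤ dartCount × s i ≡ s j
  repeat s with Fin.pigeonhole (ℕ.n<1+n dartCount) (encode ∘ s ∘ toℕ)
  ... | i , j , i<j , eq = toℕ i , toℕ j , i<j , Fin.toℕ≤pred[n] j , encode-injective eq

  -- Two iterates coincide by finiteness, and injectivity cancels their common initial steps. The
  -- return starts from `next T d`, so that it is never empty; this is the `suc` in the choice of
  -- `r`.
  return : ∀ T d → IncDart d → ∃[ r ] iter (next T) r (next T d) ≡ d
  return T d inc with repeat (λ i → iter (next T) i d)
  ... | i , j , i<j , _ , eq = r , sym (iter-injective T i inc
      (iter-inc T r (next-inc T d inc)) (begin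
    iter (next T) i d                               ≡⟨ eq ⟩
    iter (next T) j d                               ≡⟨ cong (λ t → iter (next T) t d) split ⟨
    iter (next T) (i ℕ.+ (r ℕ.+ 1)) d               ≡⟨ iter-+ (next T) i (r ℕ.+ 1) d ⟩
    iter (next T) i (iter (next T) (r ℕ.+ 1) d)
      ≡⟨ cong (iter (next T) i) (iter-+ (next T) r 1 d) ⟩
    iter (next T) i (iter (next T) r (next T d))    ∎))
    where
    open ≡-Reasoning
    r = j ∸ suc i
    split : i ℕ.+ (r ℕ.+ 1) ≡ j
    split = trans (rearrange i r) (ℕ.m∸n+n≡m i<j)
      where
      rearrange : ∀ i r → i ℕ.+ (r ℕ.+ 1) ≡ r ℕ.+ suc i
      rearrange = solve-∀

  module _ {T g χ} (cut : Cut (remove G T g) g χ) where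
    open Cut cut

    endpoint-unique : ∀ {x z} → Inc G x g → Inc G z g → χ x ≡ χ z → x ≡ z
    endpoint-unique (inj₁ refl) (inj₁ refl) _  = refl
    endpoint-unique (inj₂ refl) (inj₂ refl) _  = refl
    endpoint-unique (inj₁ refl) (inj₂ refl) eq = contradiction eq ends-differ
    endpoint-unique (inj₂ refl) (inj₁ refl) eq = contradiction (sym eq) ends-differ

    far-end : ∀ {z} → Inc G z g → χ (other G z g) ≢ χ z
    far-end (inj₁ refl) eq = ends-differ (sym eq)
    far-end (inj₂ refl) eq = ends-differ eq

    -- An edge of `T` between the two sides must be `g`, and the only dart of `g` on the side of `z`
    -- is `(z , g)`.
    stays : ∀ {z} → Inc G z g → ∀ d → IncDart d → χ (proj₁ d) ≡ χ z → d ≢ (z , g) →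
      χ (proj₁ (next T d)) ≡ χ z
    stays z-inc (x , e) inc side d≢ with T e in e∈T
    ... | false = side
    ... | true with e ≟ g
    ...   | yes refl = contradiction (cong (_, g) (endpoint-unique inc z-inc side)) d≢
    ...   | no  e≢g  = trans (across inc) side
      where
      e-respects : χ (emN e) ≡ χ (viN e)
      e-respects = respects e (trans (remove-≢ T e≢g) e∈T)
      across : ∀ {x} → Inc G x e → χ (other G x e) ≡ χ x
      across (inj₁ refl) = sym e-respects
      across (inj₂ refl) = e-respects

    -- By `stays`, the last dart on the side of `z` before the end must be `(z , g)`.
    crossing : ∀ {z} → Inc G z g → ∀ t {d} → IncDart d → χ (proj₁ d) ≡ χ z →
      χ (proj₁ (iter (next T) t d)) ≢ χ z → ∃[ j ] j < t × iter (next T) j d ≡ (z , g)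
    crossing z-inc zero inc side crossed = contradiction side crossed
    crossing {z} z-inc (suc t) {d} inc side crossed
      with χ (proj₁ (iter (next T) t d)) Bool.≟ χ z
    ... | no before with crossing z-inc t inc side before
    ...   | j , j<t , eq = j , ℕ.m<n⇒m<1+n j<t , eq
    crossing {z} z-inc (suc t) {d} inc side crossed
        | yes same with iter (next T) t d ≟D (z , g)
    ...   | yes eq = t , ℕ.n<1+n t , eq
    ...   | no  ne = contradiction (stays z-inc _ (iter-inc T t inc) same ne) crossed

    -- Between two entries into the far side through (u , g), the tour would have closed up.
    far-side-first : ∀ {u} → Inc G u g → ∀ {i t d td} → tour T i ≡ (u , g) → i < t →
      χ (proj₁ (tour T t)) ≡ χ u → Least (λ j → tour T j ≡ d) td → χ (proj₁ d) ≢ χ u → td < t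
    far-side-first {u} u-inc {i} {t} {d} {td} at-i i<t near first far with td ℕ.<? t
    ... | yes td<t = td<t
    ... | no  td≮t with crossing u-inc (td ∸ t) (tour-inc T t) near
                          (λ eq → far (trans (cong (χ ∘ proj₁) (sym at-d)) eq))
      where
      at-d : iter (next T) (td ∸ t) (tour T t) ≡ d
      at-d = trans (sym (iter-+ (next T) (td ∸ t) t _))
        (trans (cong (tour T) (ℕ.m∸n+n≡m (ℕ.≮⇒≥ td≮t))) (proj₁ first))
    ...   | j , j<td∸t , again = contradiction
      (trans at-i (sym (trans (iter-+ (next T) j t _) again)))
      (least-no-repeat (next T) first (ℕ.<-≤-trans i<t (ℕ.m≤n+m t j))
        (ℕ.≤-trans (ℕ.+-monoˡ-≤ t (ℕ.<⇒≤ j<td∸t)) (ℕ.≤-reflexive (ℕ.m∸n+n≡m (ℕ.≮⇒≥ td≮t)))))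

  -- The tour visits every dart

  Visited : EdgeSet G → Dart → Set
  Visited T d = ∃[ i ] tour T i ≡ d

  Visited-next : ∀ {T d} → Visited T d → Visited T (next T d)
  Visited-next {T} (i , refl) = suc i , refl

  Visited-iter : ∀ {T d} j → Visited T d → Visited T (iter (next T) j d)
  Visited-iter zero    visited = visited
  Visited-iter (suc j) visited = Visited-next (Visited-iter j visited)

  module _ {T} (tree : SpanningTree G T) where

    -- The orbit of (x , e) is a cycle, so the tour must come back across e.
    Visited-flip : ∀ {x e} → T e ≡ true → Inc G x e →
      Visited T (x , e) → Visited T (other G x e , e)
    Visited-flip {x} {e} e∈T inc visited with fundamental-cut tree e∈T | return T (x , e) inc
    ... | χ , cut | r , back with crossing cut (other-inc e inc) r (next-inc T (x , e) inc)
            (cong (χ ∘ proj₁) (next-∈ {T} {x} e∈T))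
            (λ eq → far-end cut inc (sym (trans (cong (χ ∘ proj₁) (sym back)) eq)))
    ...   | j , _ , eq = subst (Visited T) eq (Visited-iter j (Visited-next visited))

    -- When `e` is in `T` the tour leaves `x` along `e`; it meets the next edge at `x` right after
    -- coming back across `e`.
    Visited-ρ : ∀ {x e} → Inc G x e → Visited T (x , e) → Visited T (x , ρ x e)
    Visited-ρ {x} {e} inc visited with T e in e∈T
    ... | false = subst (Visited T) (next-∉ {T} {x} e∈T) (Visited-next visited)
    ... | true  = subst (Visited T)
      (trans (next-∈ {T} {other G x e} e∈T)
        (cong (λ y → y , ρ y e) (other-involutive e inc)))
      (Visited-next (Visited-flip e∈T inc visited))

    Visited-around : ∀ {x e f} → Inc G x e → Inc G x f → Visited T (x , e) → Visited T (x , f)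
    Visited-around {x} {e} {f} e-inc f-inc visited with ρ-cyclic x e f e-inc f-inc
    ... | j , eq = subst (λ f → Visited T (x , f)) eq (proj₂ (turn j))
      where
      turn : ∀ j → Inc G x (iter (ρ x) j e) × Visited T (x , iter (ρ x) j e)
      turn zero    = e-inc , visited
      turn (suc j) = ρ-inc x _ (proj₁ (turn j)) , Visited-ρ (proj₁ (turn j)) (proj₂ (turn j))

    Visited-along : ∀ {x y} → Reach G T x y → (∀ f → Inc G x f → Visited T (x , f)) →
      ∀ f → Inc G y f → Visited T (y , f)
    Visited-along here at-x = at-x
    Visited-along (step {e = e} e∈T inc r) at-x = Visited-along r λ f f-inc →
      Visited-around (other-inc e inc) f-inc (Visited-flip e∈T inc (at-x e inc))

    -- Starting at `b₀`, walks in `T` spread the property that all darts at a node are visited.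
    Visited-all : ∀ d → IncDart d → Visited T d
    Visited-all (y , f) inc = Visited-along (proj₁ tree b₀ y)
      (λ f f-inc → Visited-around b-inc f-inc (0 , refl)) f inc

  First : EdgeSet G → Dart → ℕ → Set
  First T d = Least (λ i → tour T i ≡ d)

  first-visit : ∀ {T} → SpanningTree G T → ∀ d → IncDart d → ∃ (First T d)
  first-visit {T} tree d inc with Visited-all tree d inc
  ... | j , eq with least (λ i → tour T i ≟D d) {j} eq
  ...   | i , _ , first = i , first

  -- By pigeonhole the tour repeats a dart by time `dartCount`, whereas up to a first visit nothing
  -- is repeated. Hence a score read up to `dartCount` covers all first visits.
  first<dartCount : ∀ {T d i} → First T d i → i < dartCount
  first<dartCount {T} {d} {i} first with i ℕ.<? dartCount
  ... | yes i<N = i<N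
  ... | no  i≮N with repeat (tour T)
  ...   | j , j′ , j<j′ , j′≤N , eq = contradiction eq
    (least-no-repeat (next T) first j<j′ (ℕ.≤-trans j′≤N (ℕ.≮⇒≥ i≮N)))

  -- For an edge outside `T` this amounts to being cut at `x`, but it applies to tree edges as well.
  -- Leastness of the time stands in for the clause of `InTourAt` that the tour has not closed up.
  FirstSeenAt : EdgeSet G → Node m n → Fin k → ℕ → Set
  FirstSeenAt T x e i = First T (x , e) i × (∀ j → j ≤ i → tour T j ≢ (other G x e , e))

  first-seen : ∀ {T} → SpanningTree G T → ∀ e →
    ∃ (FirstSeenAt T (emN e) e) ⊎ ∃ (FirstSeenAt T (viN e) e)
  first-seen {T} tree e with first-visit tree (emN e , e) (inj₁ refl)
                            | first-visit tree (viN e , e) (inj₂ refl)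
  ... | i , first | i′ , first′ with ℕ.<-cmp i i′
  ...   | tri< i<i′ _ _ = inj₁ (i , first , λ j j≤i → proj₂ first′ j (ℕ.≤-<-trans j≤i i<i′))
  ...   | tri> _ _ i′<i = inj₂ (i′ , first′ , λ j j≤i′ → proj₂ first j (ℕ.≤-<-trans j≤i′ i′<i))
  ...   | tri≈ _ refl _ with () ← trans (sym (proj₁ first)) (proj₁ first′)

  unseen : ∀ {T x e i} → Inc G x e → FirstSeenAt T x e i → ∀ j → j < i → proj₂ (tour T j) ≢ e
  unseen {T} {x} {e} inc (first , no-other) j j<i eq
    with endpoints inc (subst (Inc G (proj₁ (tour T j))) eq (tour-inc T j))
  ... | inj₁ same = proj₂ first j j<i (cong₂ _,_ same eq)
  ... | inj₂ flip = no-other j (ℕ.<⇒≤ j<i) (cong₂ _,_ flip eq)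

-- Dissection

any-or-all : ∀ {k} {A B : Fin k → Set} → (∀ e → A e ⊎ B e) → ∃ A ⊎ (∀ e → B e)
any-or-all {zero}  choice = inj₂ λ ()
any-or-all {suc k} choice with choice zero | any-or-all (choice ∘ suc)
... | inj₁ a | _            = inj₁ (zero , a)
... | inj₂ _ | inj₁ (e , a) = inj₁ (suc e , a)
... | inj₂ b | inj₂ bs      = inj₂ λ { zero → b ; (suc e) → bs e }

size : ∀ {k} → (Fin k → Bool) → ℕ
size {zero}  S = 0
size {suc k} S = (if S zero then 1 else 0) ℕ.+ size (S ∘ suc)

indicator-mono : ∀ {b c : Bool} → (b ≡ true → c ≡ true) →
  (if b then 1 else 0) ≤ (if c then 1 else 0)
indicator-mono {false} b⇒c = ℕ.z≤n
indicator-mono {true}  b⇒c rewrite b⇒c refl = ℕ.≤-refl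

size-mono : ∀ {k} {S′ S : Fin k → Bool} → (∀ e → S′ e ≡ true → S e ≡ true) → size S′ ≤ size S
size-mono {zero}  sub = ℕ.≤-refl
size-mono {suc k} sub = ℕ.+-mono-≤ (indicator-mono (sub zero)) (size-mono (sub ∘ suc))

size-strict : ∀ {k} {S′ S : Fin k → Bool} → (∀ e → S′ e ≡ true → S e ≡ true) →
  ∀ g → S g ≡ true → S′ g ≡ false → size S′ < size S
size-strict sub zero    g∈ g∉ rewrite g∈ | g∉ = s≤s (size-mono (sub ∘ suc))
size-strict sub (suc g) g∈ g∉ =
  ℕ.+-mono-≤-< (indicator-mono (sub zero)) (size-strict (sub ∘ suc) g g∈ g∉)

-1* : ∀ q → - 1ℚ * q ≡ - q
-1* q = trans (sym (ℚ.neg-distribˡ-* 1ℚ q)) (cong -_ (ℚ.*-identityˡ q))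

true-xor≢false-xor : ∀ c → true xor c ≢ false xor c
true-xor≢false-xor true  ()
true-xor≢false-xor false ()

xor-differ : ∀ {a b c d} → a ≢ b → c ≢ d → a xor c ≡ b xor d
xor-differ {true}  {true}  a≢b _ = contradiction refl a≢b
xor-differ {false} {false} a≢b _ = contradiction refl a≢b
xor-differ {true}  {false} {true}  {false} _ _ = refl
xor-differ {true}  {false} {false} {true}  _ _ = refl
xor-differ {false} {true}  {true}  {false} _ _ = refl
xor-differ {false} {true}  {false} {true}  _ _ = refl
xor-differ {c = true}  {true}  _ c≢d = contradiction refl c≢d
xor-differ {c = false} {false} _ c≢d = contradiction refl c≢d

module Dissection {m n k : ℕ} (G : BipartiteGraph m n k) (R : RibbonStructure G)
                  (b₀ : Node m n) (b : Fin k) (b-inc : Inc G b₀ b) where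
  open BipartiteGraph G
  open Graph G
  open Tours G R b₀ b b-inc

  Jaeger : EdgeSet G → Set
  Jaeger = VCutJaeger G R b₀ b

  Jaeger⇒first-seen : ∀ {T} → Jaeger T → ∀ e → T e ≡ false → ∃ (FirstSeenAt T (viN e) e)
  Jaeger⇒first-seen {T} (_ , cut) e e∉T with cut e e∉T
  ... | l , (at , _) , no-other with least (λ i → tour T i ≟D (viN e , e)) {l} at
  ...   | i , i≤l , first = i , first , λ j j≤i → no-other j (ℕ.≤-trans j≤i i≤l)

  -- If the tour had returned to `(b₀ , b)` by the time of a first visit, it would have repeated its
  -- dart at time 0.
  first-seen⇒Jaeger : ∀ {T} → SpanningTree G T →
    (∀ e → T e ≡ false → ∃ (FirstSeenAt T (viN e) e)) → Jaeger T
  first-seen⇒Jaeger {T} tree seen = tree , λ e e∉T →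
    let i , first , no-other = seen e e∉T
    in i , (proj₁ first , λ j 1≤j j≤i eq → least-no-repeat (next T) first 1≤j j≤i (sym eq)) ,
       no-other

  -- Comparing two tours, and disjointness of interiors

  AgreeBelow : EdgeSet G → EdgeSet G → ℕ → Set
  AgreeBelow T T′ i = ∀ j → j < i → T (proj₂ (tour T j)) ≡ T′ (proj₂ (tour T j))

  tours-agree : ∀ {T T′ i} → AgreeBelow T T′ i → ∀ j → j ≤ i → tour T j ≡ tour T′ j
  tours-agree agree zero    _   = refl
  tours-agree {T} {T′} agree (suc j) j<i = trans
    (next-cong {T} {T′} (tour T j) (agree j j<i))
    (cong (next T′) (tours-agree agree j (ℕ.<⇒≤ j<i)))

  first-difference : ∀ {T T′} → SpanningTree G T → ∀ e → T e ≢ T′ e →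
    ∃[ i ] AgreeBelow T T′ i × T (proj₂ (tour T i)) ≢ T′ (proj₂ (tour T i))
  first-difference {T} {T′} tree e differ with Visited-all tree (emN e , e) (inj₁ refl)
  ... | l , at with least {λ i → T (proj₂ (tour T i)) ≢ T′ (proj₂ (tour T i))}
                      (λ i → ¬? (T (proj₂ (tour T i)) Bool.≟ T′ (proj₂ (tour T i)))) {l}
                      (subst (λ d → T (proj₂ d) ≢ T′ (proj₂ d)) (sym at) differ)
  ...   | i , _ , (ne , below) = i , (λ j j<i → eq? j (below j j<i)) , ne
    where
    eq? : ∀ j → ¬ (T (proj₂ (tour T j)) ≢ T′ (proj₂ (tour T j))) →
      T (proj₂ (tour T j)) ≡ T′ (proj₂ (tour T j))
    eq? j ¬ne with T (proj₂ (tour T j)) Bool.≟ T′ (proj₂ (tour T j))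
    ... | yes eq = eq
    ... | no  ne = contradiction ne ¬ne

  crossing-∉ : ∀ {T g χ} → Cut (remove G T g) g χ → ∀ {f} → f ≢ g →
    χ (emN f) ≢ χ (viN f) → T f ≡ false
  crossing-∉ {T} cut f≢g crosses =
    trans (sym (remove-≢ T f≢g)) (¬-not (crosses ∘ Cut.respects cut _))

  true≢false : ∀ {b c : Bool} → b ≡ true → c ≡ false → b ≢ c
  true≢false refl refl ()

  -- The difference `d` of two representations of `p` is balanced. Across the fundamental cut of `g`
  -- in `T`, edges in the direction of `g` other than `g` lie in neither tree, edges in the opposite
  -- direction lie outside `T` and have `d e = c′ e`, and `d g = - c g` is negative. Such a flow is
  -- one-way.
  separated : ∀ {T T′ p i x g} → Jaeger T → Jaeger T′ → AgreeBelow T T′ i →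
    tour T i ≡ (x , g) → T g ≡ true → T′ g ≡ false →
    InInteriorQT G T p → ¬ InQT G T′ p
  separated {T} {T′} {p} {i} {x} {g} J J′ agree at-i g∈T g∉T′
    (c , (_ , _ , c-point) , c-supp , c-pos) (c′ , (c′≥0 , _ , c′-point) , c′-supp)
    with fundamental-cut (proj₁ J) g∈T
  ... | χ , cut = contradiction dg<0 (no-one-way-flow balanced χ out in′ g em-side vi-side)
    where
    open Cut cut

    g-unseen : ∀ j → j < i → proj₂ (tour T j) ≢ g
    g-unseen j j<i eq = true≢false g∈T g∉T′
      (trans (cong T (sym eq)) (trans (agree j j<i) (cong T′ eq)))

    at-i′ : tour T′ i ≡ (x , g)
    at-i′ = trans (sym (tours-agree {T} {T′} agree i ℕ.≤-refl)) at-i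

    -- T′ cuts g at its violet end, and both tours see g for the first time now.
    x≡vi : x ≡ viN g
    x≡vi with subst IncDart at-i (tour-inc T i) | Jaeger⇒first-seen J′ g g∉T′
    ... | inj₂ eq   | _ = eq
    ... | inj₁ refl | l , first , no-other with l ℕ.<? i
    ...   | yes l<i = contradiction
      (cong proj₂ (trans (tours-agree {T} {T′} agree l (ℕ.<⇒≤ l<i)) (proj₁ first))) (g-unseen l l<i)
    ...   | no  l≮i = contradiction at-i′ (no-other i (ℕ.≮⇒≥ l≮i))

    at-vi : tour T i ≡ (viN g , g)
    at-vi = trans at-i (cong (_, g) x≡vi)

    -- An edge f ∉ T not yet seen at time i would be cut at its emerald end, on the far side of g.
    outgoing-∉T′ : ∀ f → f ≢ g → χ (emN f) ≡ true → χ (viN f) ≡ false → T f ≡ false → T′ f ≡ false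
    outgoing-∉T′ f f≢g em-far vi-near f∉T with Jaeger⇒first-seen J f f∉T
    ... | l , first , no-other with ℕ.<-cmp l i
    ...   | tri< l<i _ _ = trans
      (subst (λ e → T′ e ≡ T e) (cong proj₂ (proj₁ first)) (sym (agree l l<i))) f∉T
    ...   | tri≈ _ refl _ = contradiction (cong proj₂ (trans (sym (proj₁ first)) at-i)) f≢g
    ...   | tri> _ _ i<l with first-visit (proj₁ J) (emN f , f) (inj₁ refl)
    ...     | td , first′ = contradiction (proj₁ first′) (no-other td (ℕ.<⇒≤ (far-side-first cut
      (inj₂ refl) at-vi i<l
      (trans (cong (χ ∘ proj₁) (proj₁ first)) (trans vi-near (sym vi-side)))
      first′ (true≢false em-far vi-side))))

    d : Fin k → ℚ
    d e = c′ e + - 1ℚ * c e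

    balanced : Balanced d
    balanced z = trans (∂-affine c′ (- 1ℚ) c z)
      (trans (cong₂ (λ a b → a + - 1ℚ * b) (sym (c′-point z)) (sym (c-point z)))
        (trans (cong (p z +_) (-1* (p z))) (ℚ.+-inverseʳ (p z))))

    d-at : ∀ {e q r} → c′ e ≡ q → c e ≡ r → d e ≡ q + - r
    d-at {q = q} {r} refl refl = cong (q +_) (-1* r)

    dg≡ : d g ≡ - c g
    dg≡ = trans (d-at (c′-supp g g∉T′) refl) (ℚ.+-identityˡ (- c g))

    dg<0 : d g <ℚ 0ℚ
    dg<0 = ℚ.≤-<-trans (ℚ.≤-reflexive dg≡) (ℚ.neg-antimono-< (c-pos g g∈T))

    out : ∀ e → χ (emN e) ≡ true → χ (viN e) ≡ false → d e ≤ℚ 0ℚ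
    out e eq₁ eq₂ with e ≟ g
    ... | yes refl = ℚ.<⇒≤ dg<0
    ... | no  e≢g  = ℚ.≤-reflexive
      (d-at (c′-supp e (outgoing-∉T′ e e≢g eq₁ eq₂ e∉T)) (c-supp e e∉T))
      where e∉T = crossing-∉ cut e≢g (true≢false eq₁ eq₂)

    in′ : ∀ e → χ (emN e) ≡ false → χ (viN e) ≡ true → 0ℚ ≤ℚ d e
    in′ e eq₁ eq₂ = ℚ.≤-trans (c′≥0 e) (ℚ.≤-reflexive (sym
      (trans (d-at refl (c-supp e (crossing-∉ cut e≢g (true≢false eq₂ eq₁ ∘ sym))))
        (ℚ.+-identityʳ (c′ e)))))
      where
      e≢g : e ≢ g
      e≢g refl = not-both em-side eq₁

  interiors-disjoint : ∀ {T T′ p} → Jaeger T → Jaeger T′ → ¬ (∀ e → T e ≡ T′ e) →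
    ¬ (InInteriorQT G T p × InInteriorQT G T′ p)
  interiors-disjoint {T} {T′} J J′ T≢T′ (int@(c , comb , supp , _) , int′@(c′ , comb′ , supp′ , _))
    with any-or-all {A = λ e → T e ≢ T′ e} {B = λ e → T e ≡ T′ e} differ?
    where
    differ? : ∀ e → T e ≢ T′ e ⊎ T e ≡ T′ e
    differ? e with T e Bool.≟ T′ e
    ... | yes eq = inj₂ eq
    ... | no  ne = inj₁ ne
  ... | inj₂ same         = T≢T′ same
  ... | inj₁ (e , differ) with first-difference {T} {T′} (proj₁ J) e differ
  ...   | i , agree , ne with T (proj₂ (tour T i)) in g∈T | T′ (proj₂ (tour T i)) in g∈T′
  ...     | true  | true  = ne refl
  ...     | false | false = ne refl
  ...     | true  | false = separated J J′ agree refl g∈T g∈T′ int (c′ , comb′ , supp′)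
  ...     | false | true  = separated J′ J agree′
    (sym (tours-agree {T} {T′} agree i ℕ.≤-refl)) g∈T′ g∈T int′ (c , comb , supp)
    where
    agree′ : AgreeBelow T′ T i
    agree′ j j<i = subst (λ d → T′ (proj₂ d) ≡ T (proj₂ d))
      (tours-agree {T} {T′} agree j (ℕ.<⇒≤ j<i)) (sym (agree j j<i))

  -- Covering: trees and pivots

  feasible-tree : ∀ {S p} → ConnectedSub G S → InQT G S p → Acc _<_ (size S) →
    ∃[ T ] SpanningTree G T × InQT G T p
  feasible-tree {S} {p} conn inS (acc rec) with any-or-all redundant?
    where
    redundant? : ∀ e → (S e ≡ true × Reach G (remove G S e) (emN e) (viN e)) ⊎
                       (S e ≡ true → ¬ Reach G (remove G S e) (emN e) (viN e))
    redundant? e with S e | reach-or-cut (remove G S e) e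
    ... | false | _              = inj₂ λ ()
    ... | true  | inj₁ r         = inj₁ (refl , r)
    ... | true  | inj₂ (χ , cut) =
      inj₂ λ _ r → Cut.ends-differ cut (Reach-respects {χ = χ} (Cut.respects cut) r)
  ... | inj₂ acyclic       = S , (conn , acyclic) , inS
  -- The redundant edge `e` only supplies a cycle; the edge deleted is the one chosen by the ratio
  -- test, and the number of edges drops.
  ... | inj₁ (e , e∈S , r) with exchange conn inS e∈S r
  ...   | g , _ , g∈S , conn′ , inS′ = feasible-tree conn′ inS′
    (rec (size-strict (λ f f∈ → proj₂ (remove-∈ S g f f∈)) g g∈S (remove-≡ S g)))

  -- Every edge `e` of the new graph has a cut separating its ends. For `e = f` it is `χ`. Otherwise
  -- it is the fundamental cut `ψ` of `e` in `T`, provided that `f` does not cross it; if `f` does,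
  -- it is `ψ xor χ`, because `f` crosses both cuts and the other edges of the new graph do not
  -- cross `χ`.
  pivot-tree : ∀ {T f g χ} → SpanningTree G T → f ≢ g → Cut (remove G T g) g χ →
    χ (emN f) ≡ true → χ (viN f) ≡ false → ConnectedSub G (remove G (insert T f) g) →
    SpanningTree G (remove G (insert T f) g)
  pivot-tree {T} {f} {g} {χ} tree f≢g cut f-em f-vi conn = conn , acyclic
    where
    T′ = remove G (insert T f) g
    open Cut cut

    T′⇒T : ∀ e → T′ e ≡ true → e ≢ f → T e ≡ true
    T′⇒T e e∈ e≢f = trans (sym (insert-≢ T e≢f)) (proj₂ (remove-∈ (insert T f) g e e∈))

    T′-respects : ∀ e → T′ e ≡ true → e ≢ f → χ (emN e) ≡ χ (viN e)
    T′-respects e e∈ e≢f = respects e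
      (trans (remove-≢ T (proj₁ (remove-∈ (insert T f) g e e∈))) (T′⇒T e e∈ e≢f))

    from-f : ∀ {e} {χ : Node m n → Bool} → χ (emN f) ≡ χ (viN f) →
      (∀ h → remove G T′ e h ≡ true → h ≢ f → χ (emN h) ≡ χ (viN h)) → Respects (remove G T′ e) χ
    from-f {e} at-f off-f h h∈ = by-cases (h ≟ f)
      where
      by-cases : Dec (h ≡ f) → _
      by-cases (yes refl) = at-f
      by-cases (no h≢f)   = off-f h h∈ h≢f

    cut-e-respects : ∀ {e} ψ → Cut (remove G T e) e ψ →
      ∀ h → remove G T′ e h ≡ true → h ≢ f → ψ (emN h) ≡ ψ (viN h)
    cut-e-respects {e} ψ cut-e h h∈ h≢f = Cut.respects cut-e h
      (trans (remove-≢ T (proj₁ (remove-∈ T′ e h h∈))) (T′⇒T h (proj₂ (remove-∈ T′ e h h∈)) h≢f))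

    other-edge : ∀ {e} → T′ e ≡ true → e ≢ f → ¬ Reach G (remove G T′ e) (emN e) (viN e)
    other-edge {e} e∈T′ e≢f r with fundamental-cut tree (T′⇒T e e∈T′ e≢f)
    ... | ψ , cut-e with ψ (emN f) Bool.≟ ψ (viN f)
    ...   | yes same = Cut.ends-differ cut-e (Reach-respects {χ = ψ} ψ-respects r)
      where
      ψ-respects : Respects (remove G T′ e) ψ
      ψ-respects = from-f {χ = ψ} same (cut-e-respects ψ cut-e)
    ...   | no differ = true-xor≢false-xor (χ (viN e)) (begin
      true xor χ (viN e)         ≡⟨ cong₂ _xor_ (Cut.em-side cut-e) (T′-respects e e∈T′ e≢f) ⟨
      ψ (emN e) xor χ (emN e)    ≡⟨ Reach-respects {χ = λ z → ψ z xor χ z} sum-respects r ⟩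
      ψ (viN e) xor χ (viN e)    ≡⟨ cong (_xor χ (viN e)) (Cut.vi-side cut-e) ⟩
      false xor χ (viN e)        ∎)
      where
      open ≡-Reasoning
      sum-respects : Respects (remove G T′ e) (λ z → ψ z xor χ z)
      sum-respects = from-f {χ = λ z → ψ z xor χ z} (xor-differ differ (true≢false f-em f-vi))
        λ h h∈ h≢f → cong₂ _xor_ (cut-e-respects ψ cut-e h h∈ h≢f)
          (T′-respects h (proj₂ (remove-∈ T′ e h h∈)) h≢f)

    acyclic : ∀ e → T′ e ≡ true → ¬ Reach G (remove G T′ e) (emN e) (viN e)
    acyclic e e∈T′ r = by-cases (e ≟ f)
      where
      by-cases : Dec (e ≡ f) → _
      by-cases (no e≢f)   = other-edge e∈T′ e≢f r
      by-cases (yes refl) = true≢false f-em f-vi (Reach-respects {χ = χ}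
        (λ h h∈ → T′-respects h (proj₂ (remove-∈ T′ e h h∈)) (proj₁ (remove-∈ T′ e h h∈))) r)

  bad : EdgeSet G → Dart → Bool
  bad T (inj₁ _ , e) = not (T e)
  bad T (inj₂ _ , e) = T e

  -- Earlier digits weigh more, so the first difference between two tours decides, however they
  -- continue.
  score : EdgeSet G → ℕ → ℕ
  score T zero    = 0
  score T (suc i) = 2 ℕ.* score T i ℕ.+ (if bad T (tour T i) then 1 else 0)

  score-agree : ∀ {T T′ i} → AgreeBelow T T′ i → ∀ j → j ≤ i → score T j ≡ score T′ j
  score-agree agree zero    _   = refl
  score-agree {T} {T′} agree (suc j) j<i = cong₂ (λ q a → 2 ℕ.* q ℕ.+ (if a then 1 else 0))
    (score-agree agree j (ℕ.<⇒≤ j<i))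
    (trans (bad-cong (tour T j) (agree j j<i))
      (cong (bad T′) (tours-agree {T} {T′} agree j (ℕ.<⇒≤ j<i))))
    where
    bad-cong : ∀ d → T (proj₂ d) ≡ T′ (proj₂ d) → bad T d ≡ bad T′ d
    bad-cong (inj₁ _ , e) eq = cong not eq
    bad-cong (inj₂ _ , e) eq = eq

  -- The digit at time `i` creates a lead of 1. Each later step doubles the lead, to at least 2, and
  -- one digit can take back at most 1.
  score-decreases : ∀ {T T′ i} → AgreeBelow T T′ i →
    bad T (tour T i) ≡ true → bad T′ (tour T i) ≡ false → ∀ {j} → i < j → score T′ j < score T j
  score-decreases {T} {T′} {i} agree bad-T good-T′ {suc j} (s≤s i≤j) with ℕ.m≤n⇒m<n∨m≡n i≤j
  ... | inj₁ i<j = begin-strict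
    2 ℕ.* score T′ j ℕ.+ digit T′   ≤⟨ ℕ.+-monoʳ-≤ (2 ℕ.* score T′ j) (digit≤1 T′) ⟩
    2 ℕ.* score T′ j ℕ.+ 1          <⟨ ℕ.+-monoʳ-< (2 ℕ.* score T′ j) (ℕ.n<1+n 1) ⟩
    2 ℕ.* score T′ j ℕ.+ 2          ≡⟨ trans (ℕ.+-comm _ 2) (sym (ℕ.*-suc 2 (score T′ j))) ⟩
    2 ℕ.* suc (score T′ j)          ≤⟨ ℕ.*-monoʳ-≤ 2 (score-decreases agree bad-T good-T′ i<j) ⟩
    2 ℕ.* score T j                 ≤⟨ ℕ.m≤m+n _ (digit T) ⟩
    2 ℕ.* score T j ℕ.+ digit T     ∎
    where
    open ℕ.≤-Reasoning
    digit : EdgeSet G → ℕ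
    digit T = if bad T (tour T j) then 1 else 0
    digit≤1 : ∀ T → digit T ≤ 1
    digit≤1 T with bad T (tour T j)
    ... | true  = ℕ.≤-refl
    ... | false = ℕ.z≤n
  ... | inj₂ refl rewrite sym (tours-agree {T} {T′} agree i ℕ.≤-refl) | bad-T | good-T′
                        | score-agree {T} {T′} agree i ℕ.≤-refl =
    ℕ.+-monoʳ-< (2 ℕ.* score T′ i) (ℕ.n<1+n 0)

  -- The fields `f-em` and `f-vi` say that `f` crosses the cut in the direction of `g`; together
  -- with the tour property this is what rules out the bad order of events in `pivot-improves`.
  record Pivot (T : EdgeSet G) (f : Fin k) (p : Point G) : Set where
    field
      g          : Fin k
      χ          : Node m n → Bool
      f≢g        : f ≢ g
      g∈T        : T g ≡ true
      cut        : Cut (remove G T g) g χ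
      f-em       : χ (emN f) ≡ true
      f-vi       : χ (viN f) ≡ false
      new-tree   : SpanningTree G (remove G (insert T f) g)
      new-inside : InQT G (remove G (insert T f) g) p

  pivot : ∀ {T p} → SpanningTree G T → InQT G T p → ∀ f → T f ≡ false → Pivot T f p
  pivot {T} {p} tree@(conn , _) (c , comb , c-supp) f f∉T
    with exchange insert-conn insert-inside (insert-≡ T f)
           (Reach-map (λ e e∈T → edge-reach (trans (remove-≢ S (T⇒≢f e∈T)) (T⇒S e∈T))) (conn _ _))
    where
    S = insert T f

    T⇒≢f : ∀ {e} → T e ≡ true → e ≢ f
    T⇒≢f e∈T refl = not-both e∈T f∉T

    T⇒S : ∀ {e} → T e ≡ true → S e ≡ true
    T⇒S e∈T = trans (insert-≢ T (T⇒≢f e∈T)) e∈T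

    insert-conn : ConnectedSub G S
    insert-conn x y = Reach-map (λ e e∈T → edge-reach (T⇒S e∈T)) (conn x y)

    insert-inside : InQT G S p
    insert-inside = c , comb , supp
      where
      supp : Supported S c
      supp e e∉S with e ≟ f
      ... | yes refl = contradiction e∉S λ ()
      ... | no  _    = c-supp e e∉S
  ... | g , (d , balanced , d-supp , df≡1 , dg<0) , g∈S , new-conn , new-inside =
    build (fundamental-cut tree g∈T)
    where
    f≢g : f ≢ g
    f≢g refl = ℚ.<-asym dg<0 (ℚ.<-≤-trans (ℚ.positive⁻¹ 1ℚ) (ℚ.≤-reflexive (sym df≡1)))

    g∈T : T g ≡ true
    g∈T = trans (sym (insert-≢ T (f≢g ∘ sym))) g∈S

    -- Only `f` and `g` in the support of `d` can cross the cut, and `d` has opposite signs on them.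
    -- As the net flow vanishes, they must cross in the same direction.
    f-side : ∀ {χ} → Cut (remove G T g) g χ → χ (emN f) ≡ true × χ (viN f) ≡ false
    f-side {χ} cut with (χ (emN f) Bool.≟ true) ×-dec (χ (viN f) Bool.≟ false)
    ... | yes crosses = crosses
    ... | no ¬crosses = contradiction dg<0
      (no-one-way-flow balanced χ out in′ g (Cut.em-side cut) (Cut.vi-side cut))
      where
      off-cycle : ∀ e → e ≢ f → e ≢ g → χ (emN e) ≢ χ (viN e) → d e ≡ 0ℚ
      off-cycle e e≢f e≢g crosses = d-supp e (trans (insert-≢ T e≢f) (crossing-∉ cut e≢g crosses))

      out : ∀ e → χ (emN e) ≡ true → χ (viN e) ≡ false → d e ≤ℚ 0ℚ
      out e em-in vi-out with e ≟ g | e ≟ f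
      ... | yes refl | _        = ℚ.<⇒≤ dg<0
      ... | no  e≢g  | no  e≢f  = ℚ.≤-reflexive (off-cycle e e≢f e≢g (true≢false em-in vi-out))
      ... | no  _    | yes refl = contradiction (em-in , vi-out) ¬crosses

      in′ : ∀ e → χ (emN e) ≡ false → χ (viN e) ≡ true → 0ℚ ≤ℚ d e
      in′ e em-out vi-in with e ≟ g | e ≟ f
      ... | yes refl | _        = not-both (Cut.em-side cut) em-out
      ... | no  e≢g  | no  e≢f  =
        ℚ.≤-reflexive (sym (off-cycle e e≢f e≢g (true≢false vi-in em-out ∘ sym)))
      ... | no  _    | yes refl = ℚ.≤-trans (ℚ.nonNegative⁻¹ 1ℚ) (ℚ.≤-reflexive (sym df≡1))

    build : ∃ (Cut (remove G T g) g) → Pivot T f p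
    build (χ , cut) = record
      { f≢g = f≢g ; g∈T = g∈T ; cut = cut
      ; f-em = proj₁ (f-side cut) ; f-vi = proj₂ (f-side cut)
      ; new-tree = pivot-tree tree f≢g cut (proj₁ (f-side cut)) (proj₂ (f-side cut)) new-conn
      ; new-inside = new-inside }

  -- The trees differ only in `f` and `g`, so the tours part when the first of these is met. If it
  -- is `f`, it is met at its emerald end and enters; if it is `g` at its violet end, it leaves. In
  -- both cases the digit drops from 1 to 0.
  pivot-improves : ∀ {T p f i} → SpanningTree G T → T f ≡ false → FirstSeenAt T (emN f) f i →
    (P : Pivot T f p) →
    score (remove G (insert T f) (Pivot.g P)) dartCount < score T dartCount
  pivot-improves {T} {p} {f} {i} tree f∉T seen-f@(first-f , no-other) P =
    compare (first-seen tree g)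
    where
    open Pivot P
    T′ = remove G (insert T f) g

    unchanged : ∀ e → e ≢ f → e ≢ g → T e ≡ T′ e
    unchanged e e≢f e≢g = sym (trans (remove-≢ (insert T f) e≢g) (insert-≢ T e≢f))

    f∈T′ : T′ f ≡ true
    f∈T′ = trans (remove-≢ (insert T f) f≢g) (insert-≡ T f)

    f-first : (∀ j → j < i → proj₂ (tour T j) ≢ g) → score T′ dartCount < score T dartCount
    f-first g-unseen = score-decreases {T} {T′} {i}
      (λ j j<i → unchanged _ (unseen (inj₁ refl) seen-f j j<i) (g-unseen j j<i))
      (trans (cong (bad T) (proj₁ first-f)) (cong not f∉T))
      (trans (cong (bad T′) (proj₁ first-f)) (cong not f∈T′))
      (first<dartCount first-f)

    not-same : ∀ {x} → tour T i ≢ (x , g)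
    not-same eq = f≢g (cong proj₂ (trans (sym (proj₁ first-f)) eq))

    compare : ∃ (FirstSeenAt T (emN g) g) ⊎ ∃ (FirstSeenAt T (viN g) g) →
      score T′ dartCount < score T dartCount
    compare (inj₁ (j , seen-g)) with ℕ.<-cmp i j
    ... | tri< i<j _ _  = f-first (λ l l<i → unseen (inj₁ refl) seen-g l (ℕ.<-trans l<i i<j))
    ... | tri≈ _ refl _ = contradiction (proj₁ (proj₁ seen-g)) not-same
    -- Had the tour met `g` first, at its emerald end, it would have exhausted the violet side of
    -- the cut before being at `emN f` at time `i`, and so would have seen `f` from its violet end
    -- first.
    ... | tri> _ _ j<i with first-visit tree (viN f , f) (inj₂ refl)
    ...   | td , first-vi = contradiction (proj₁ first-vi) (no-other td (ℕ.<⇒≤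
      (far-side-first cut (inj₁ refl) (proj₁ (proj₁ seen-g)) j<i
        (trans (cong (χ ∘ proj₁) (proj₁ first-f)) (trans f-em (sym (Cut.em-side cut))))
        first-vi (true≢false (Cut.em-side cut) f-vi ∘ sym))))
    compare (inj₂ (j , seen-g)) with ℕ.<-cmp i j
    ... | tri< i<j _ _  = f-first (λ l l<i → unseen (inj₂ refl) seen-g l (ℕ.<-trans l<i i<j))
    ... | tri≈ _ refl _ = contradiction (proj₁ (proj₁ seen-g)) not-same
    ... | tri> _ _ j<i  = score-decreases {T} {T′} {j}
      (λ l l<j → unchanged _ (unseen (inj₁ refl) seen-f l (ℕ.<-trans l<j j<i))
        (unseen (inj₂ refl) seen-g l l<j))
      (trans (cong (bad T) (proj₁ (proj₁ seen-g))) g∈T)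
      (trans (cong (bad T′) (proj₁ (proj₁ seen-g))) (remove-≡ (insert T f) g))
      (first<dartCount (proj₁ seen-g))

  improve : ∀ {T p} → SpanningTree G T → InQT G T p → Acc _<_ (score T dartCount) →
    ∃[ T′ ] Jaeger T′ × InQT G T′ p
  improve {T} {p} tree inside (acc rec) with any-or-all choice
    where
    choice : ∀ e → (T e ≡ false × ∃ (FirstSeenAt T (emN e) e)) ⊎
                   (T e ≡ false → ∃ (FirstSeenAt T (viN e) e))
    choice e with T e | first-seen tree e
    ... | true  | _           = inj₂ λ ()
    ... | false | inj₁ seen   = inj₁ (refl , seen)
    ... | false | inj₂ seen   = inj₂ λ _ → seen
  ... | inj₂ seen = T , first-seen⇒Jaeger tree seen , inside
  ... | inj₁ (f , f∉T , i , seen) = improve (Pivot.new-tree P) (Pivot.new-inside P)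
    (rec (pivot-improves tree f∉T seen P))
    where P = pivot tree inside f f∉T

  covered : Connected G → ∀ {p} → InQG G p → ∃[ T ] Jaeger T × InQT G T p
  covered conn (c , comb) with feasible-tree conn (c , comb , λ _ ()) (<-wellFounded _)
  ... | T , tree , inside = improve tree inside (<-wellFounded _)

theorem7p6 : ∀ {m n k : ℕ} (G : BipartiteGraph m n k) → Connected G →
    (R : RibbonStructure G) (b₀ : Node m n) (b : Fin k) → Inc G b₀ b →
    Dissects G (VCutJaeger G R b₀ b)
theorem7p6 G conn R b₀ b b-inc =
  (λ p → covered conn) ,
  (λ { T p _ (c , comb , _) → c , comb }) ,
  (λ T T′ J J′ T≢T′ p → interiors-disjoint J J′ T≢T′)
  where open Dissection G R b₀ b b-inc
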